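{- Let $\alpha,\gamma$ be such that $\alpha+\gamma\ge1+o(1)$. Suppose there is a lower bound of $\Omega(n^{\alpha}\cdot p^{\gamma})$ edges for reachability preservers with $p$ pairs for $n$-vertex graphs (i.e., for all $n$ and $p$ there are an $n$-vertex directed graph $G$ and a set of $p$ vertex pairs such that every reachability preserver of $G$ for these pairs has $\Omega(n^\alpha p^\gamma)$ edges). Then there exists an $n$-vertex directed graph for which any $d$-shortcut of linear size (i.e., with $O(n)$ edges) must satisfy $d\ge n^{\alpha+\gamma-1-o(1)}$.
   Context: For a directed graph $G=(V,E)$, $TC(G)$ denotes its transitive closure. A $d$-shortcut for $G$ is a set $H\subseteq TC(G)$ such that for every $(u,v)\in TC(G)$ the graph $G\cup H$ contains a directed $u$-$v$ path with at most $d$ edges. A reachability preserver of $G$ for a pair set $P\subseteq V\times V$ is a subgraph $G'\subseteq G$ containing a directed $u$-$v$ path for every $(u,v)\in TC(G)\cap P$. The $o(1)$ terms are as $n\to\infty$. -}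

module Defs where

open import Data.Nat as ℕ using (ℕ; suc)
import Data.Nat.Properties as ℕₚ
open import Data.Integer as ℤ using (ℤ; +_; -[1+_])
open import Data.Rational as ℚ using (ℚ; 0ℚ; 1ℚ; ½; ↥_; ↧_; ↧ₙ_)
import Data.Rational.Properties as ℚₚ
open import Algebra.Bundles using (CommutativeSemigroup; CommutativeMonoid)
import Algebra.Properties.CommutativeSemigroup as CommSemigroup
open import Data.Fin using (Fin; combine)
open import Data.Fin.Subset using (Subset; ∣_∣; _∈_; _∪_)
open import Data.Product using (Σ; ∃; _×_; _,_)
open import Level using (0ℓ)
open import Relation.Binary.Core using (Rel; _⇒_)
open import Relation.Binary.PropositionalEquality
open import Relation.Binary.Construct.Closure.Transitive using (TransClosure)
open import Relation.Binary.Construct.Closure.ReflexiveTransitive using (Star; ε; _◅_)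

------------------------------------------------------------------------
-- Real numbers: Cauchy sequences of rationals with a modulus (the modulus
-- is the witness of the existential).  Two sequences denote the same real
-- when each is ≤ᴿ the other; every notion below depends on a sequence only
-- through its tail behaviour up to arbitrarily small errors.

IsCauchy : (ℕ → ℚ) → Set
IsCauchy s = ∀ δ → 0ℚ ℚ.< δ →
  ∃ λ N → ∀ i j → N ℕ.≤ i → N ℕ.≤ j → ℚ.∣ s i ℚ.- s j ∣ ℚ.< δ

record ℝ : Set where
  constructor mkℝ
  field
    seq    : ℕ → ℚ
    cauchy : IsCauchy seq
open ℝ public

infixl 6 _+ᴿ_ _-ᴿ_
infix  4 _≤ᴿ_ _<ᴿ_

fromℚ : ℚ → ℝ
fromℚ q = mkℝ (λ _ → q) λ δ 0<δ →
  0 , λ _ _ _ _ → subst (ℚ._< δ) (sym (cong ℚ.∣_∣ (ℚₚ.+-inverseʳ q))) 0<δ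

private
  +-commSemigroup : CommutativeSemigroup 0ℓ 0ℓ
  +-commSemigroup = CommutativeMonoid.commutativeSemigroup ℚₚ.+-0-commutativeMonoid

  +-interchange : ∀ a b c d → (a ℚ.+ b) ℚ.+ (c ℚ.+ d) ≡ (a ℚ.+ c) ℚ.+ (b ℚ.+ d)
  +-interchange = CommSemigroup.interchange +-commSemigroup

  half-pos : ∀ {δ} → 0ℚ ℚ.< δ → 0ℚ ℚ.< ½ ℚ.* δ
  half-pos {δ} 0<δ =
    subst (ℚ._< ½ ℚ.* δ) (ℚₚ.*-zeroʳ ½) (ℚₚ.*-monoʳ-<-pos ½ 0<δ)

  halves : ∀ δ → ½ ℚ.* δ ℚ.+ ½ ℚ.* δ ≡ δ
  halves δ = trans (sym (ℚₚ.*-distribʳ-+ δ ½ ½)) (ℚₚ.*-identityˡ δ)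

  +-diff : ∀ a b c d → (a ℚ.- c) ℚ.+ (b ℚ.- d) ≡ (a ℚ.+ b) ℚ.- (c ℚ.+ d)
  +-diff a b c d = trans (+-interchange a (ℚ.- c) b (ℚ.- d))
    (cong (a ℚ.+ b ℚ.+_) (sym (ℚₚ.neg-distrib-+ c d)))

_+ᴿ_ : ℝ → ℝ → ℝ
x +ᴿ y = mkℝ (λ i → seq x i ℚ.+ seq y i) λ δ 0<δ →
  let (M , hx) = cauchy x (½ ℚ.* δ) (half-pos 0<δ)
      (N , hy) = cauchy y (½ ℚ.* δ) (half-pos 0<δ)
  in M ℕ.⊔ N , λ i j i≥ j≥ →
    subst₂ ℚ._<_ (cong ℚ.∣_∣ (+-diff (seq x i) (seq y i) (seq x j) (seq y j)))
      (halves δ)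
      (ℚₚ.≤-<-trans (ℚₚ.∣p+q∣≤∣p∣+∣q∣ (seq x i ℚ.- seq x j) (seq y i ℚ.- seq y j))
        (ℚₚ.+-mono-<
          (hx i j (ℕₚ.m⊔n≤o⇒m≤o M N i≥) (ℕₚ.m⊔n≤o⇒m≤o M N j≥))
          (hy i j (ℕₚ.m⊔n≤o⇒n≤o M N i≥) (ℕₚ.m⊔n≤o⇒n≤o M N j≥))))

-ᴿ_ : ℝ → ℝ
-ᴿ x = mkℝ (λ i → ℚ.- seq x i) λ δ 0<δ →
  let (N , h) = cauchy x δ 0<δ
  in N , λ i j i≥ j≥ → subst (ℚ._< δ)
    (trans (sym (ℚₚ.∣-p∣≡∣p∣ (seq x i ℚ.- seq x j)))
      (cong ℚ.∣_∣ (ℚₚ.neg-distrib-+ (seq x i) (ℚ.- seq x j))))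
    (h i j i≥ j≥)

_-ᴿ_ : ℝ → ℝ → ℝ
x -ᴿ y = x +ᴿ (-ᴿ y)

1ᴿ : ℝ
1ᴿ = fromℚ 1ℚ

_≤ᴿ_ : Rel ℝ 0ℓ
x ≤ᴿ y = ∀ δ → 0ℚ ℚ.< δ → ∃ λ N → ∀ i → N ℕ.≤ i → seq x i ℚ.≤ seq y i ℚ.+ δ

_<ᴿ_ : Rel ℝ 0ℓ
x <ᴿ y = ∃ λ δ → 0ℚ ℚ.< δ × ∃ λ N → ∀ i → N ℕ.≤ i → seq x i ℚ.+ δ ℚ.≤ seq y i

-- The function f is o(1), as its argument tends to infinity.
IsLittleO1 : (ℕ → ℝ) → Set
IsLittleO1 f = ∀ δ → 0ℚ ℚ.< δ →
  ∃ λ N → ∀ n → N ℕ.≤ n → fromℚ (ℚ.- δ) ≤ᴿ f n × f n ≤ᴿ fromℚ δ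

------------------------------------------------------------------------
-- Comparing real powers with natural numbers.

_⁺ : ℤ → ℕ
(+ a) ⁺      = a
-[1+ _ ] ⁺   = 0

_⁻ : ℤ → ℕ
z ⁻ = (ℤ.- z) ⁺

-- n ^ q ≤ m for rational q = a / b with b > 0 and n ≥ 1, i.e. n ^ a ≤ m ^ b,
-- where a = a⁺ - a⁻ and the negative part is moved to the right.
_^ℚ_≤_ : ℕ → ℚ → ℕ → Set
n ^ℚ q ≤ m = n ℕ.^ ((↥ q) ⁺) ℕ.≤ m ℕ.^ (↧ₙ q) ℕ.* n ℕ.^ ((↥ q) ⁻)

-- n ^ q * p ^ r ≤ m for rational q, r and n , p ≥ 1: both sides are raised to
-- the power ↧ₙ q * ↧ₙ r, and negative exponents are moved to the right.
_^ℚ_·_^ℚ_≤_ : ℕ → ℚ → ℕ → ℚ → ℕ → Set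
n ^ℚ q · p ^ℚ r ≤ m =
  n ℕ.^ (a ⁺) ℕ.* p ℕ.^ (b ⁺)
    ℕ.≤ m ℕ.^ (↧ₙ q ℕ.* ↧ₙ r) ℕ.* (n ℕ.^ (a ⁻) ℕ.* p ℕ.^ (b ⁻))
  where
  a b : ℤ
  a = ↥ q ℤ.* ↧ r
  b = ↥ r ℤ.* ↧ q

-- For n ≥ 1 the real power n ^ x is the supremum of n ^ q over rational q < x,
-- so n ^ x ≤ m says that m is an upper bound of these numbers.  Meaningful only
-- for bases ≥ 1; likewise for products of two powers.
_^ᴿ_≤_ : ℕ → ℝ → ℕ → Set
n ^ᴿ x ≤ m = ∀ q → fromℚ q <ᴿ x → n ^ℚ q ≤ m

_^ᴿ_·_^ᴿ_≤_ : ℕ → ℝ → ℕ → ℝ → ℕ → Set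
n ^ᴿ x · p ^ᴿ y ≤ m =
  ∀ q r → fromℚ q <ᴿ x → fromℚ r <ᴿ y → n ^ℚ q · p ^ℚ r ≤ m

------------------------------------------------------------------------
-- Directed graphs on the vertex set Fin n.

-- A set of ordered pairs of vertices; (u , v) is coded as combine u v.  (A
-- record rather than a synonym so that n can be inferred.)
record PairSet (n : ℕ) : Set where
  constructor pairSet
  field
    codes : Subset (n ℕ.* n)
open PairSet public

-- A graph is given by its edge set E ⊆ V × V.
Digraph : ℕ → Set
Digraph = PairSet

size : ∀ {n} → PairSet n → ℕ
size E = ∣ codes E ∣

_∪ᴾ_ : ∀ {n} → PairSet n → PairSet n → PairSet n
E ∪ᴾ F = pairSet (codes E ∪ codes F)

⟦_⟧ : ∀ {n} → PairSet n → Rel (Fin n) 0ℓ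
⟦ E ⟧ u v = combine u v ∈ codes E

TC : ∀ {n} → Digraph n → Rel (Fin n) 0ℓ
TC G = TransClosure ⟦ G ⟧

-- Directed walks.  A shortest walk repeats no vertex, so a u-v path (with at
-- most d edges) exists exactly when such a walk does; a vertex reaches itself
-- by the path without edges.
Path : ∀ {n} → Digraph n → Rel (Fin n) 0ℓ
Path G = Star ⟦ G ⟧

hops : ∀ {n} {G : Digraph n} {u v} → Path G u v → ℕ
hops ε       = 0
hops (_ ◅ π) = suc (hops π)

record IsShortcut {n} (d : ℕ) (G : Digraph n) (H : PairSet n) : Set where
  field
    inTC  : ⟦ H ⟧ ⇒ TC G
    short : ∀ {u v} → TC G u v → Σ (Path (G ∪ᴾ H) u v) λ π → hops π ℕ.≤ d

record IsPreserver {n} (G : Digraph n) (P : PairSet n) (G′ : Digraph n) : Set where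
  field
    subgraph : ⟦ G′ ⟧ ⇒ ⟦ G ⟧
    reaches  : ∀ {u v} → TC G u v → ⟦ P ⟧ u v → Path G′ u v

-- Reachability preservers need Ω(n ^ α * p ^ γ) edges.  The hidden constant is
-- 1 / k; p ranges over all possible sizes of a nonempty set of pairs.
PreserverLowerBound : ℝ → ℝ → Set
PreserverLowerBound α γ =
  ∃ λ k → ∃ λ n₀ → ∀ n p → n₀ ℕ.≤ n → 1 ℕ.≤ p → p ℕ.≤ n ℕ.* n →
  Σ (Digraph n) λ G → Σ (PairSet n) λ P → size P ≡ p ×
  (∀ G′ → IsPreserver G P G′ → n ^ᴿ α · p ^ᴿ γ ≤ (k ℕ.* size G′))

{-# OPTIONS --safe #-}
module Submission where

open import Defs
open import Data.Bool using (true; false)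
open import Data.Fin as Fin using (Fin; toℕ)
import Data.Fin.Properties as Finₚ
open import Data.Fin.Subset as Subset using (Subset; inside; outside)
import Data.Fin.Subset.Properties as Subsetₚ
open import Data.Integer as ℤ using (ℤ; -[1+_])
import Data.Integer.Properties as ℤₚ
import Data.Integer.Tactic.RingSolver as ℤ-Solver
open import Data.List as List using (List; []; _∷_; length; filter; allFin; map; _++_)
import Data.List.Properties as Listₚ
open import Data.List.Membership.Propositional using (_∈_)
import Data.List.Membership.Propositional.Properties as ∈ₚ
open import Data.List.Relation.Unary.All as All using (All; []; _∷_)
import Data.List.Relation.Unary.All.Properties as Allₚ
open import Data.List.Relation.Unary.AllPairs using ([]; _∷_)
open import Data.List.Relation.Unary.Any as Any using (here; there)
import Data.List.Relation.Unary.Any.Properties as Anyₚ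
open import Data.List.Relation.Unary.Unique.Propositional using (Unique)
import Data.List.Relation.Unary.Unique.Propositional.Properties as Uniqueₚ
open import Data.Nat
open import Data.Nat.Divisibility using (divides-refl)
open import Data.Nat.DivMod
open import Data.Nat.ListAction using (sum)
open import Data.Nat.Properties
open import Data.Nat.Tactic.RingSolver using (solve-∀)
open import Data.Product using (Σ; ∃; _×_; _,_; proj₁; proj₂; uncurry)
open import Data.Rational as ℚ using (ℚ; 0ℚ; 1ℚ; ½; ↥_; ↧_; ↧ₙ_)
import Data.Rational.Properties as ℚₚ
import Data.Rational.Solver as ℚ-Solver
open import Data.Rational.Unnormalised as ℚᵘ using (mkℚᵘ)
import Data.Rational.Unnormalised.Properties as ℚᵘₚ
open import Data.Sum using (_⊎_; inj₁; inj₂; [_,_]′)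
open import Data.Vec as Vec using (Vec; []; _∷_)
open import Function using (Injective)
open import Level using (0ℓ)
open import Relation.Binary.Construct.Closure.ReflexiveTransitive as Star using (Star; ε; _◅_; _◅◅_)
open import Relation.Binary.Construct.Closure.Transitive using ([_]; _∷_)
open import Relation.Binary.Core using (Rel; _⇒_)
open import Relation.Binary.Definitions using (tri<; tri≈; tri>) renaming (Decidable to Decidable₂)
open import Relation.Binary.PropositionalEquality
open import Relation.Nullary using (¬_; Dec; yes; no; does; contradiction)
open import Relation.Nullary.Decidable using (map′; _×-dec_; _⊎-dec_; _→-dec_; ¬?; decidable-stable)
open import Relation.Unary using (Decidable)

-- Let D be the least hop bound such that every n-vertex graph has a D-shortcut with at most
-- L n edges, L = 1 + ⌊log₂ n⌋; the hard graph is one without a (D - 1)-shortcut of that size.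
-- It remains to see that every n-vertex graph G has a reachability preserver for n given pairs
-- with only n D polylog(n) edges, since comparing with n ^ (α + γ) bounds D from below.
--
-- Let s = 2 L and K = M s for M = 1, 2, 4, ….  A greedy set S of n / M vertices meets all
-- geodesics of length K, so that walks of G become walks in the graph on S joining vertices at
-- distance at most K.  On n vertices there is room for M disjoint copies of that graph; a
-- D-shortcut of the union with at most L n edges puts at most L n / M of them into some copy.
-- Hence any q pairs are connected using 3 q D K edges of G and L n / M shortcut edges, and these
-- shortcut edges are the pairs to be connected for the next value of M.  Each round starts with
-- q ≤ 2 L n / M pairs and so costs at most 6 L n D s edges.

-- Walks of bounded length

data Within {A : Set} (R : Rel A 0ℓ) : ℕ → Rel A 0ℓ where
  stay : ∀ {k u} → Within R k u u
  step : ∀ {k u v w} → R u v → Within R k v w → Within R (suc k) u w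

module _ {A : Set} {R : Rel A 0ℓ} where

  within-mono : ∀ {k l u v} → k ≤ l → Within R k u v → Within R l u v
  within-mono _         stay       = stay
  within-mono (s≤s k≤l) (step r p) = step r (within-mono k≤l p)

  within-trans : ∀ {k l u v w} → Within R k u v → Within R l v w → Within R (k + l) u w
  within-trans {k} stay q = within-mono (m≤n+m _ k) q
  within-trans (step r p) q = step r (within-trans p q)

  within-split : ∀ k {l u w} → Within R (k + l) u w →
                 ∃ λ v → Within R k u v × Within R l v w
  within-split zero    p          = _ , stay , p
  within-split (suc k) stay       = _ , stay , stay
  within-split (suc k) (step r p) = let v , p₁ , p₂ = within-split k p in v , step r p₁ , p₂

  within⇒star : ∀ {k u v} → Within R k u v → Star R u v
  within⇒star stay       = ε
  within⇒star (step r p) = r ◅ within⇒star p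

  star⇒within : ∀ {u v} → Star R u v → ∃ λ k → Within R k u v
  star⇒within ε       = 0 , stay
  star⇒within (r ◅ p) = let k , q = star⇒within p in suc k , step r q

within-map : ∀ {A} {R S : Rel A 0ℓ} → R ⇒ S → ∀ {k} → Within R k ⇒ Within S k
within-map f stay       = stay
within-map f (step r p) = step (f r) (within-map f p)

module _ {n} {R : Rel (Fin n) 0ℓ} (R? : Decidable₂ R) where

  within? : ∀ k → Decidable₂ (Within R k)
  within? zero    u v = map′ (λ { refl → stay }) (λ { stay → refl }) (u Finₚ.≟ v)
  within? (suc k) u v = map′
    (λ { (inj₁ refl) → stay ; (inj₂ (_ , r , p)) → step r p })
    (λ { stay → inj₁ refl ; (step r p) → inj₂ (_ , r , p) })
    (u Finₚ.≟ v ⊎-dec Finₚ.any? (λ w → R? u w ×-dec within? k w v))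

module _ {n} {R : Rel (Fin n) 0ℓ} where

  -- The start u is excluded, so that moving on to a hit point always makes progress.
  OnWalk : ℕ → Fin n → Fin n → Fin n → Set
  OnWalk k u w v = ∃ λ (i : Fin k) → Within R (suc (toℕ i)) u v × Within R (k ∸ suc (toℕ i)) v w

  -- A walk that cannot be shortened by one step repeats no vertex: cutting out the stretch between
  -- two equal points would save at least a step.
  geodesic : ∀ {k u w} → Within R (suc k) u w → ¬ Within R k u w →
             Σ (Fin (suc k) → Fin n) λ f → Injective _≡_ _≡_ f × ∀ i → OnWalk (suc k) u w (f i)
  geodesic {k} {u} {w} p ¬q = f , (λ {i} {j} → inj i j) , on
    where
    pt : (i : Fin (suc k)) → ∃ λ v → Within R (suc (toℕ i)) u v × Within R (k ∸ toℕ i) v w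
    pt i = within-split (suc (toℕ i))
      (subst (λ l → Within R l u w) (cong suc (sym (m+[n∸m]≡n (Finₚ.toℕ≤pred[n] i)))) p)
    f = λ i → proj₁ (pt i)
    on : ∀ i → OnWalk (suc k) u w (f i)
    on i = i , proj₂ (pt i)
    no< : ∀ i j → toℕ i < toℕ j → f i ≡ f j → Within R k u w
    no< i j i<j eq = within-mono le (within-trans (proj₁ (proj₂ (pt i)))
        (subst (λ v → Within R (k ∸ toℕ j) v w) (sym eq) (proj₂ (proj₂ (pt j)))))
      where
      le : suc (toℕ i) + (k ∸ toℕ j) ≤ k
      le = ≤-trans (+-monoˡ-≤ _ i<j) (≤-reflexive (m+[n∸m]≡n (Finₚ.toℕ≤pred[n] j)))
    inj : ∀ i j → f i ≡ f j → i ≡ j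
    inj i j eq with <-cmp (toℕ i) (toℕ j)
    ... | tri< i<j _ _ = contradiction (no< i j i<j eq) ¬q
    ... | tri≈ _ i≡j _ = Finₚ.toℕ-injective i≡j
    ... | tri> _ _ j<i = contradiction (no< j i j<i (sym eq)) ¬q

  -- A walk of `suc k` steps, more than `K`, either shortens by a step or has `suc k` distinct
  -- points by `geodesic`, which is too many for `n ≤ K`. Hence reachability reduces to walks of at
  -- most `n` steps and is decidable.
  within-shrink : Decidable₂ R → ∀ {K} → n ≤ K → ∀ k {u v} → Within R k u v → Within R K u v
  within-shrink R? n≤K zero    stay = stay
  within-shrink R? {K} n≤K (suc k) {u} {v} p with suc k ≤? K | within? R? k u v
  ... | yes k<K | _     = within-mono k<K p
  ... | no  _   | yes q = within-shrink R? n≤K k q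
  ... | no  k≮K | no ¬q =
    contradiction (≤-trans (Finₚ.injective⇒≤ (proj₁ (proj₂ (geodesic p ¬q)))) n≤K) k≮K

-- Counting and greedy hitting sets

sum-map-≤ : ∀ {A : Set} {f g : A → ℕ} xs → All (λ x → f x ≤ g x) xs → sum (map f xs) ≤ sum (map g xs)
sum-map-≤ []       []       = z≤n
sum-map-≤ (x ∷ xs) (p ∷ ps) = +-mono-≤ p (sum-map-≤ xs ps)

sum-map-const : ∀ {A : Set} c (xs : List A) → sum (map (λ _ → c) xs) ≡ length xs * c
sum-map-const c []       = refl
sum-map-const c (x ∷ xs) = cong (c +_) (sum-map-const c xs)

sum-≤-length*max : ∀ {A : Set} (f : A → ℕ) x xs → ∃ λ y → sum (map f (x ∷ xs)) ≤ length (x ∷ xs) * f y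
sum-≤-length*max f x []        = x , ≤-refl
sum-≤-length*max f x (x′ ∷ xs) with sum-≤-length*max f x′ xs
... | y , h with f x ≤? f y
... | yes p = y , +-mono-≤ p h
... | no ¬p = x , +-monoʳ-≤ (f x) (≤-trans h (*-monoʳ-≤ (length (x′ ∷ xs)) (≰⇒≥ ¬p)))

length*min-≤-sum : ∀ {A : Set} (f : A → ℕ) x xs → ∃ λ y → length (x ∷ xs) * f y ≤ sum (map f (x ∷ xs))
length*min-≤-sum f x []        = x , ≤-refl
length*min-≤-sum f x (x′ ∷ xs) with length*min-≤-sum f x′ xs
... | y , h with f x ≤? f y
... | yes p = x , +-monoʳ-≤ (f x) (≤-trans (*-monoʳ-≤ (length (x′ ∷ xs)) p) h)
... | no ¬p = y , +-mono-≤ (≰⇒≥ ¬p) h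

+-swap : ∀ x y z → x + (y + z) ≡ y + (x + z)
+-swap = solve-∀

module _ {A B : Set} {I : A → B → Set} (I? : ∀ a b → Dec (I a b)) where

  degree : List B → A → ℕ
  degree ys a = length (filter (I? a) ys)

  codegree : List A → B → ℕ
  codegree xs b = length (filter (λ a → I? a b) xs)

  codegree-∷ : ∀ a xs ys → sum (map (codegree (a ∷ xs)) ys) ≡ degree ys a + sum (map (codegree xs) ys)
  codegree-∷ a xs []       = refl
  codegree-∷ a xs (b ∷ ys)
    with does (I? a b) | trans (cong (codegree xs b +_) (codegree-∷ a xs ys)) (+-swap (codegree xs b) (degree ys a) _)
  ... | true  | eq = cong suc eq
  ... | false | eq = eq

  double-count : ∀ xs ys → sum (map (degree ys) xs) ≡ sum (map (codegree xs) ys)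
  double-count []       ys = sym (trans (sum-map-const 0 ys) (*-zeroʳ (length ys)))
  double-count (a ∷ xs) ys = trans (cong (degree ys a +_) (double-count xs ys)) (sym (codegree-∷ a xs ys))

  length-filter-¬ : ∀ xs b → codegree xs b + length (filter (λ a → ¬? (I? a b)) xs) ≡ length xs
  length-filter-¬ []       b = refl
  length-filter-¬ (a ∷ xs) b with I? a b
  ... | yes _ = cong suc (length-filter-¬ xs b)
  ... | no _  = trans (+-suc _ _) (cong suc (length-filter-¬ xs b))

-- The position of `f i` in the filtered list determines `f i` and hence `i`, so `Fin k` injects
-- into the positions.
≤-length-filter : ∀ {n k} {P : Fin n → Set} (P? : Decidable P) (f : Fin k → Fin n) →
                  Injective _≡_ _≡_ f → (∀ i → P (f i)) → k ≤ length (filter P? (allFin n))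
≤-length-filter {n} P? f f-inj Pf = Finₚ.injective⇒≤ {f = λ i → Any.index (pos i)} λ {i} {j} eq →
  f-inj (trans (Anyₚ.lookup-index (pos i))
    (trans (cong (List.lookup fs) eq) (sym (Anyₚ.lookup-index (pos j)))))
  where
  fs = filter P? (allFin n)
  pos : ∀ i → f i ∈ fs
  pos i = ∈ₚ.∈-filter⁺ P? (∈ₚ.∈-allFin (f i)) (Pf i)

unique-subsingleton : ∀ {A : Set} {P : A → Set} {xs} → Unique xs → All P xs →
                      (∀ {a b} → P a → P b → a ≡ b) → length xs ≤ 1
unique-subsingleton []                     _             _  = z≤n
unique-subsingleton ([] ∷ _)               _             _  = s≤s z≤n
unique-subsingleton ((a≢b ∷ _) ∷ _)        (p ∷ q ∷ _)   eq = contradiction (eq p q) a≢b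



-- Bernoulli's inequality (1 + k/a)^t ≥ 1 + tk/a, multiplied by a^(t+1) to avoid division.
bernoulli : ∀ a k t → a ^ t * a + t * k * a ^ t ≤ (a + k) ^ t * a
bernoulli a k zero    = ≤-reflexive (+-identityʳ _)
bernoulli a k (suc t) = begin
  a * a ^ t * a + (k + t * k) * (a * a ^ t)             ≤⟨ m≤m+n _ (k * (t * k * a ^ t)) ⟩
  a * a ^ t * a + (k + t * k) * (a * a ^ t) + k * (t * k * a ^ t)
                                                        ≡⟨ rearrange a k t (a ^ t) ⟩
  (a + k) * (a ^ t * a + t * k * a ^ t)                 ≤⟨ *-monoʳ-≤ (a + k) (bernoulli a k t) ⟩
  (a + k) * ((a + k) ^ t * a)                           ≡⟨ *-assoc (a + k) _ a ⟨
  (a + k) * (a + k) ^ t * a                             ∎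
  where
  open ≤-Reasoning
  rearrange : ∀ a k t x → a * x * a + (k + t * k) * (a * x) + k * (t * k * x) ≡ (a + k) * (x * a + t * k * x)
  rearrange = solve-∀

doubling : ∀ a k t → 1 ≤ a → a ≤ t * k → 2 * a ^ t ≤ (a + k) ^ t
doubling a@(suc _) k t _ a≤tk = *-cancelʳ-≤ (2 * a ^ t) _ a (begin
  2 * a ^ t * a              ≡⟨ rearrange (a ^ t) a ⟩
  a ^ t * a + a * a ^ t      ≤⟨ +-monoʳ-≤ (a ^ t * a) (*-monoˡ-≤ (a ^ t) a≤tk) ⟩
  a ^ t * a + t * k * a ^ t  ≤⟨ bernoulli a k t ⟩
  (a + k) ^ t * a            ∎)
  where
  open ≤-Reasoning
  rearrange : ∀ x a → 2 * x * a ≡ x * a + a * x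
  rearrange = solve-∀

^-distribʳ-* : ∀ a b k → (a * b) ^ k ≡ a ^ k * b ^ k
^-distribʳ-* a b zero    = refl
^-distribʳ-* a b (suc k) = trans (cong (a * b *_) (^-distribʳ-* a b k)) (rearrange a b (a ^ k) (b ^ k))
  where
  rearrange : ∀ a b x y → a * b * (x * y) ≡ a * x * (b * y)
  rearrange = solve-∀

-- One greedy choice scales the number of survivors by at most a/(a+k). By `doubling`, `t` choices
-- halve it, so `t * s` choices bring `M < 2 ^ s` objects below one; the remaining `r` choices do no
-- harm.
greedy-beats : ∀ a k M s t b → 1 ≤ a → a ≤ t * k → M < 2 ^ s → t * s ≤ b →
               a ^ b * M < (a + k) ^ b
greedy-beats a@(suc _) k M s t b 1≤a a≤tk M<2^s ts≤b = begin-strict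
  a ^ b * M                     ≡⟨ cong (λ e → a ^ e * M) (sym eq) ⟩
  a ^ (t * s + r) * M           ≡⟨ cong (_* M) (trans (^-distribˡ-+-* a (t * s) r) (cong (_* a ^ r) (sym (^-*-assoc a t s)))) ⟩
  (a ^ t) ^ s * a ^ r * M       ≡⟨ *-comm _ M ⟩
  M * ((a ^ t) ^ s * a ^ r)     <⟨ *-monoˡ-< ((a ^ t) ^ s * a ^ r) {{pos}} M<2^s ⟩
  2 ^ s * ((a ^ t) ^ s * a ^ r) ≡⟨ *-assoc (2 ^ s) _ _ ⟨
  2 ^ s * (a ^ t) ^ s * a ^ r   ≡⟨ cong (_* a ^ r) (sym (^-distribʳ-* 2 (a ^ t) s)) ⟩
  (2 * a ^ t) ^ s * a ^ r       ≤⟨ *-mono-≤ (^-monoˡ-≤ s (doubling a k t 1≤a a≤tk)) (^-monoˡ-≤ r (m≤m+n a k)) ⟩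
  ((a + k) ^ t) ^ s * (a + k) ^ r ≡⟨ trans (cong (_* (a + k) ^ r) (^-*-assoc (a + k) t s)) (sym (^-distribˡ-+-* (a + k) (t * s) r)) ⟩
  (a + k) ^ (t * s + r)         ≡⟨ cong ((a + k) ^_) eq ⟩
  (a + k) ^ b                   ∎
  where
  open ≤-Reasoning
  r = b ∸ t * s
  eq : t * s + r ≡ b
  eq = m+[n∸m]≡n ts≤b
  pos : NonZero ((a ^ t) ^ s * a ^ r)
  pos = m*n≢0 _ _ {{m^n≢0 (a ^ t) s {{m^n≢0 a t}}}} {{m^n≢0 a r}}

module _ {A : Set} {n : ℕ} {I : A → Fin n → Set} (I? : ∀ a v → Dec (I a v)) where

  Heavy : ℕ → A → Set
  Heavy k a = k ≤ degree I? (allFin n) a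

  -- Averaging: at least `length xs * k` incidences are spread over `n` vertices.
  popular : 1 ≤ n → ∀ {k} xs → All (Heavy k) xs → ∃ λ v → length xs * k ≤ n * codegree I? xs v
  popular (s≤s _) {k} xs heavy with sum-≤-length*max (codegree I? xs) Fin.zero (List.tabulate Fin.suc)
  ... | v , h = v , (begin
    length xs * k                               ≡⟨ sum-map-const k xs ⟨
    sum (map (λ _ → k) xs)                      ≤⟨ sum-map-≤ xs heavy ⟩
    sum (map (degree I? (allFin n)) xs)         ≡⟨ double-count I? xs (allFin n) ⟩
    sum (map (codegree I? xs) (allFin n))       ≤⟨ h ⟩
    length (allFin n) * codegree I? xs v        ≡⟨ cong (_* codegree I? xs v) (Listₚ.length-tabulate {n = n} (λ i → i)) ⟩
    n * codegree I? xs v                        ∎)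
    where open ≤-Reasoning

  -- Each choice is a `popular` vertex, which meets at least a share k/n of the objects still unhit
  -- and leaves at most a/n of them.
  greedy : ∀ {a k} → n ≡ a + k → 1 ≤ n → ∀ b xs → All (Heavy k) xs →
           Σ (Vec (Fin n) b) λ S → Σ (List A) λ ys → n ^ b * length ys ≤ a ^ b * length xs ×
           (∀ {x} → x ∈ xs → x ∈ ys ⊎ ∃ λ i → I x (Vec.lookup S i))
  greedy eq 1≤n zero    xs heavy = Vec.[] , xs , ≤-refl , inj₁
  greedy {a} {k} eq 1≤n (suc b) xs heavy
    with v , h ← popular 1≤n xs heavy
    with S , ys , le , hit ← greedy eq 1≤n b (filter (λ x → ¬? (I? x v)) xs) (Allₚ.filter⁺ _ heavy)
    = v Vec.∷ S , ys , bound , hit′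
    where
    open ≤-Reasoning
    xs′ = filter (λ x → ¬? (I? x v)) xs
    remaining : n * length xs′ ≤ a * length xs
    remaining = +-cancelˡ-≤ (length xs * k) _ _ (begin
      length xs * k + n * length xs′              ≤⟨ +-monoˡ-≤ _ h ⟩
      n * codegree I? xs v + n * length xs′       ≡⟨ *-distribˡ-+ n _ (length xs′) ⟨
      n * (codegree I? xs v + length xs′)         ≡⟨ cong₂ _*_ eq (length-filter-¬ I? xs v) ⟩
      (a + k) * length xs                         ≡⟨ rearrange a k (length xs) ⟩
      length xs * k + a * length xs               ∎)
      where
      rearrange : ∀ a k l → (a + k) * l ≡ l * k + a * l
      rearrange = solve-∀
    bound : n ^ suc b * length ys ≤ a ^ suc b * length xs
    bound = begin
      n * n ^ b * length ys     ≡⟨ *-assoc n _ _ ⟩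
      n * (n ^ b * length ys)   ≤⟨ *-monoʳ-≤ n le ⟩
      n * (a ^ b * length xs′)  ≡⟨ x∙yz≈y∙xz n (a ^ b) _ ⟩
      a ^ b * (n * length xs′)  ≤⟨ *-monoʳ-≤ (a ^ b) remaining ⟩
      a ^ b * (a * length xs)   ≡⟨ x∙yz≈yx∙z (a ^ b) a _ ⟩
      a * a ^ b * length xs     ∎
      where open import Algebra.Properties.CommutativeSemigroup *-commutativeSemigroup
    hit′ : ∀ {x} → x ∈ xs → x ∈ ys ⊎ ∃ λ i → I x (Vec.lookup (v Vec.∷ S) i)
    hit′ {x} x∈xs with I? x v
    ... | yes p = inj₂ (Fin.zero , p)
    ... | no ¬p with hit (∈ₚ.∈-filter⁺ _ x∈xs ¬p)
    ...   | inj₁ x∈ys    = inj₁ x∈ys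
    ...   | inj₂ (i , p) = inj₂ (Fin.suc i , p)

  -- Were some object still unhit after `b` choices, then n^b ≤ a^b · `length xs` < n^b by `greedy`
  -- and `greedy-beats`.
  hitting-set : ∀ {a k s t b} xs → All (Heavy k) xs → n ≡ a + k → 1 ≤ a → a ≤ t * k →
                length xs < 2 ^ s → t * s ≤ b →
                Σ (Vec (Fin n) b) λ S → ∀ {x} → x ∈ xs → ∃ λ i → I x (Vec.lookup S i)
  hitting-set {a} {k} {s} {t} {b} xs heavy refl 1≤a a≤tk M<2^s ts≤b
    with greedy refl (≤-trans 1≤a (m≤m+n a k)) b xs heavy
  ... | S , []     , _  , hit = S , λ x∈xs → [ (λ ()) , (λ p → p) ]′ (hit x∈xs)
  ... | S , y ∷ ys , le , hit = contradiction
    (≤-<-trans (≤-trans (m≤m*n (n ^ b) (length (y ∷ ys))) le) (greedy-beats a k _ s t b 1≤a a≤tk M<2^s ts≤b))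
    (<-irrefl refl)

-- Pair sets as lists

elements : ∀ {m} → Subset m → List (Fin m)
elements []            = []
elements (inside  ∷ p) = Fin.zero ∷ map Fin.suc (elements p)
elements (outside ∷ p) = map Fin.suc (elements p)

length-elements : ∀ {m} (p : Subset m) → length (elements p) ≡ Subset.∣ p ∣
length-elements []            = refl
length-elements (inside  ∷ p) = cong suc (trans (Listₚ.length-map Fin.suc (elements p)) (length-elements p))
length-elements (outside ∷ p) = trans (Listₚ.length-map Fin.suc (elements p)) (length-elements p)

∈-elements⁺ : ∀ {m x} {p : Subset m} → x Subset.∈ p → x ∈ elements p
∈-elements⁺ {p = inside  ∷ p} Vec.here      = here refl
∈-elements⁺ {p = inside  ∷ p} (Vec.there h) = there (∈ₚ.∈-map⁺ Fin.suc (∈-elements⁺ h))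
∈-elements⁺ {p = outside ∷ p} (Vec.there h) = ∈ₚ.∈-map⁺ Fin.suc (∈-elements⁺ h)

∈-elements⁻ : ∀ {m x} (p : Subset m) → x ∈ elements p → x Subset.∈ p
∈-elements⁻ (inside  ∷ p) (here refl) = Vec.here
∈-elements⁻ (inside  ∷ p) (there h) with ∈ₚ.∈-map⁻ Fin.suc h
... | y , y∈p , refl = Vec.there (∈-elements⁻ p y∈p)
∈-elements⁻ (outside ∷ p) h with ∈ₚ.∈-map⁻ Fin.suc h
... | y , y∈p , refl = Vec.there (∈-elements⁻ p y∈p)

∣p∪q∣≤∣p∣+∣q∣ : ∀ {m} (p q : Subset m) → Subset.∣ p Subset.∪ q ∣ ≤ Subset.∣ p ∣ + Subset.∣ q ∣
∣p∪q∣≤∣p∣+∣q∣ []            []            = z≤n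
∣p∪q∣≤∣p∣+∣q∣ (inside  ∷ p) (inside  ∷ q) =
  s≤s (≤-trans (∣p∪q∣≤∣p∣+∣q∣ p q) (+-monoʳ-≤ Subset.∣ p ∣ (n≤1+n _)))
∣p∪q∣≤∣p∣+∣q∣ (inside  ∷ p) (outside ∷ q) = s≤s (∣p∪q∣≤∣p∣+∣q∣ p q)
∣p∪q∣≤∣p∣+∣q∣ (outside ∷ p) (inside  ∷ q) =
  ≤-trans (s≤s (∣p∪q∣≤∣p∣+∣q∣ p q)) (≤-reflexive (sym (+-suc _ _)))
∣p∪q∣≤∣p∣+∣q∣ (outside ∷ p) (outside ∷ q) = ∣p∪q∣≤∣p∣+∣q∣ p q

length-cartesianProduct : ∀ {A B : Set} (xs : List A) (ys : List B) →
                          length (List.cartesianProduct xs ys) ≡ length xs * length ys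
length-cartesianProduct []       ys = refl
length-cartesianProduct (x ∷ xs) ys = trans (Listₚ.length-++ (map (x ,_) ys))
  (cong₂ _+_ (Listₚ.length-map (x ,_) ys) (length-cartesianProduct xs ys))

module _ {n : ℕ} where

  pairs : PairSet n → List (Fin n × Fin n)
  pairs E = map (Fin.remQuot {n} n) (elements (codes E))

  length-pairs : ∀ E → length (pairs E) ≡ size E
  length-pairs E = trans (Listₚ.length-map (Fin.remQuot {n} n) (elements (codes E))) (length-elements (codes E))

  ∈-pairs⁺ : ∀ {E u v} → ⟦ E ⟧ u v → (u , v) ∈ pairs E
  ∈-pairs⁺ {E} {u} {v} h = subst (_∈ pairs E) (Finₚ.remQuot-combine u v) (∈ₚ.∈-map⁺ (Fin.remQuot {n} n) (∈-elements⁺ h))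

  ∈-pairs⁻ : ∀ E {u v} → (u , v) ∈ pairs E → ⟦ E ⟧ u v
  ∈-pairs⁻ E h with ∈ₚ.∈-map⁻ (Fin.remQuot {n} n) h
  ... | c , c∈ , eq = subst (Subset._∈ codes E)
    (trans (sym (Finₚ.combine-remQuot {n} n c)) (cong (uncurry Fin.combine) (sym eq))) (∈-elements⁻ (codes E) c∈)

  fromPairs : List (Fin n × Fin n) → PairSet n
  fromPairs []             = pairSet Subset.⊥
  fromPairs ((u , v) ∷ es) = pairSet (Subset.⁅ Fin.combine u v ⁆ Subset.∪ codes (fromPairs es))

  size-fromPairs : ∀ es → size (fromPairs es) ≤ length es
  size-fromPairs []             = ≤-reflexive (Subsetₚ.∣⊥∣≡0 (n * n))
  size-fromPairs ((u , v) ∷ es) = ≤-trans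
    (∣p∪q∣≤∣p∣+∣q∣ Subset.⁅ Fin.combine u v ⁆ _)
    (+-mono-≤ (≤-reflexive (Subsetₚ.∣⁅x⁆∣≡1 (Fin.combine u v))) (size-fromPairs es))

  fromPairs⁺ : ∀ {es u v} → (u , v) ∈ es → ⟦ fromPairs es ⟧ u v
  fromPairs⁺ {_ ∷ es} (here refl) = Subsetₚ.x∈p∪q⁺ (inj₁ (Subsetₚ.x∈⁅x⁆ _))
  fromPairs⁺ {_ ∷ es} (there h)   = Subsetₚ.x∈p∪q⁺ (inj₂ (fromPairs⁺ h))

  fromPairs⁻ : ∀ es {u v} → ⟦ fromPairs es ⟧ u v → (u , v) ∈ es
  fromPairs⁻ []             h = contradiction h Subsetₚ.∉⊥
  fromPairs⁻ ((a , b) ∷ es) {u} {v} h with Subsetₚ.x∈p∪q⁻ Subset.⁅ Fin.combine a b ⁆ _ h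
  ... | inj₂ h′ = there (fromPairs⁻ es h′)
  ... | inj₁ h′ with Finₚ.combine-injective u v a b (Subsetₚ.x∈⁅y⁆⇒x≡y _ h′)
  ...   | refl , refl = here refl

  allPairs : List (Fin n × Fin n)
  allPairs = List.cartesianProduct (allFin n) (allFin n)

  ∈-allPairs : ∀ u v → (u , v) ∈ allPairs
  ∈-allPairs u v = ∈ₚ.∈-cartesianProduct⁺ (∈ₚ.∈-allFin u) (∈ₚ.∈-allFin v)

  length-allPairs : length allPairs ≡ n * n
  length-allPairs = trans (length-cartesianProduct (allFin n) (allFin n))
    (cong₂ _*_ (Listₚ.length-tabulate {n = n} (λ i → i)) (Listₚ.length-tabulate {n = n} (λ i → i)))

  adjacent? : ∀ (E : PairSet n) → Decidable₂ ⟦ E ⟧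
  adjacent? E u v = Fin.combine u v Subsetₚ.∈? codes E

  relationGraph : {R : Rel (Fin n) 0ℓ} → Decidable₂ R → Digraph n
  relationGraph R? = fromPairs (filter (uncurry R?) allPairs)

  relationGraph⁺ : ∀ {R : Rel (Fin n) 0ℓ} (R? : Decidable₂ R) → R ⇒ ⟦ relationGraph R? ⟧
  relationGraph⁺ R? r = fromPairs⁺ (∈ₚ.∈-filter⁺ (uncurry R?) (∈-allPairs _ _) r)

  relationGraph⁻ : ∀ {R : Rel (Fin n) 0ℓ} (R? : Decidable₂ R) → ⟦ relationGraph R? ⟧ ⇒ R
  relationGraph⁻ R? h = proj₂ (∈ₚ.∈-filter⁻ (uncurry R?) {xs = allPairs} (fromPairs⁻ _ h))

-- Routing through a hitting set

module _ {A : Set} (R : Rel A 0ℓ) (J : List (A × A)) where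

  -- Only edges of `R` are charged to the budget. Jumps are free because the pairs in `J` are
  -- connected, and paid for, in the next round.
  data Route : ℕ → A → A → Set where
    done : ∀ {k u} → Route k u u
    edge : ∀ {k u v w} → R u v → Route k v w → Route (suc k) u w
    jump : ∀ {k u v w} → (u , v) ∈ J → Route k v w → Route k u w

module _ {A : Set} {R : Rel A 0ℓ} {J : List (A × A)} where

  route-mono : ∀ {k l u v} → k ≤ l → Route R J k u v → Route R J l u v
  route-mono _         done       = done
  route-mono (s≤s k≤l) (edge r p) = edge r (route-mono k≤l p)
  route-mono k≤l       (jump j p) = jump j (route-mono k≤l p)

  route-trans : ∀ {k l u v w} → Route R J k u v → Route R J l v w → Route R J (k + l) u w
  route-trans {k} done q = route-mono (m≤n+m _ k) q
  route-trans (edge r p) q = edge r (route-trans p q)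
  route-trans (jump j p) q = jump j (route-trans p q)

  within⇒route : ∀ {k u v} → Within R k u v → Route R J k u v
  within⇒route stay       = done
  within⇒route (step r p) = edge r (within⇒route p)

-- A reflexive reading of `IsShortcut` with a bound on the size: `Star` and `Within` are decidable
-- on finite graphs, as the search for the least hop bound requires.
HasShortcut : ∀ {n} → ℕ → ℕ → Digraph n → Set
HasShortcut {n} B D Γ = Σ (PairSet n) λ H → size H ≤ B × (⟦ H ⟧ ⇒ Star ⟦ Γ ⟧) × (Star ⟦ Γ ⟧ ⇒ Within ⟦ Γ ∪ᴾ H ⟧ D)

ShortcutsExist : ℕ → ℕ → ℕ → Set
ShortcutsExist n B D = (Γ : Digraph n) → HasShortcut B D Γ

module _ {n} {R : Rel (Fin n) 0ℓ} (R? : Decidable₂ R) {k b : ℕ} (S : Fin b → Fin n)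
         (hit : ∀ {u w} → Within R (suc k) u w → ¬ Within R k u w → ∃ λ t → OnWalk {R = R} (suc k) u w (S t)) where

  private
    K = suc k

  Near : Rel (Fin b) 0ℓ
  Near t t′ = Within R K (S t) (S t′)

  Relayed : Rel (Fin n) 0ℓ
  Relayed u v = Within R K u v ⊎ ∃ λ t → ∃ λ t′ → Within R K u (S t) × Star Near t t′ × Within R K (S t′) v

  relay-step : ∀ {u t v} → Within R K u (S t) → Relayed (S t) v → Relayed u v
  relay-step {t = t} p (inj₁ q)                    = inj₂ (t , t , p , ε , q)
  relay-step {t = t} p (inj₂ (t₁ , t₂ , q , s , r)) = inj₂ (t , t₂ , p , q ◅ s , r)

  -- Consider the first `K` steps of a long walk. If their end is also reachable in `k` steps, the
  -- walk shortens; otherwise they form a geodesic, which `hit` supplies with a relay from which to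
  -- continue.
  relayed : ∀ fuel {ℓ u v} → ℓ ≤ fuel → Within R ℓ u v → Relayed u v
  relayed zero z≤n p = inj₁ (within-mono z≤n p)
  relayed (suc fuel) {ℓ} {u} {v} ℓ≤ p with ℓ ≤? K
  ... | yes ℓ≤K = inj₁ (within-mono ℓ≤K p)
  ... | no  ℓ≰K with r , refl ← m≤n⇒∃[o]m+o≡n (≰⇒≥ ℓ≰K)
                with x , p₁ , p₂ ← within-split K p
                with within? R? k u x
  ... | yes q = relayed fuel (s≤s⁻¹ ℓ≤) (within-trans q p₂)
  ... | no ¬q with hit p₁ ¬q
  -- The relay lies at least one step after `u`, so the rest of the walk is shorter and the fuel
  -- suffices.
  ... | t , i , q₁ , q₂ = relay-step (within-mono (Finₚ.toℕ<n i) q₁)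
    (relayed fuel (≤-trans (+-monoˡ-≤ r (m∸n≤m k (toℕ i))) (s≤s⁻¹ ℓ≤)) (within-trans q₂ p₂))

  module _ {m} (blk : Fin n → ℕ) (ψ : Fin n → Fin n) (rep : Fin (suc m) → Fin b → Fin n)
           (blk-rep : ∀ i t → blk (rep i t) ≡ toℕ i) (ψ-rep : ∀ i t → ψ (rep i t) ≡ S t)
           {B D} (shortcuts : ShortcutsExist n B D) where

    -- One disjoint copy of Near per block: some copy receives at most a 1/(m+1) share of the shortcut edges.
    Copies : Rel (Fin n) 0ℓ
    Copies x y = blk x ≡ blk y × Within R K (ψ x) (ψ y)

    copies? : Decidable₂ Copies
    copies? x y = (blk x ≟ blk y) ×-dec within? R? K (ψ x) (ψ y)

    private
      Γ = relationGraph copies?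
      H = proj₁ (shortcuts Γ)
      H≤B = proj₁ (proj₂ (shortcuts Γ))
      H⊆Γ* = proj₁ (proj₂ (proj₂ (shortcuts Γ)))
      short = proj₂ (proj₂ (proj₂ (shortcuts Γ)))

    -- Since shortcut edges join vertices reachable in `Γ`, this confines each of them to one copy
    -- and makes its projection a reachable pair of `R`.
    copies-sound : ∀ {x y} → Star ⟦ Γ ⟧ x y → blk x ≡ blk y × Star R (ψ x) (ψ y)
    copies-sound ε = refl , ε
    copies-sound (r ◅ p) with relationGraph⁻ copies? r | copies-sound p
    ... | e , q | e′ , q′ = trans e e′ , within⇒star q ◅◅ q′

    InBlock : Fin n × Fin n → Fin (suc m) → Set
    InBlock xy i = blk (proj₁ xy) ≡ toℕ i

    inBlock? : ∀ xy i → Dec (InBlock xy i)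
    inBlock? xy i = blk (proj₁ xy) ≟ toℕ i

    -- Averaging again: the block of its first vertex is the only one in which an edge of `H` is
    -- counted, so the counts over `suc m` blocks add up to at most `B`.
    sparse-block : ∃ λ i → suc m * codegree inBlock? (pairs H) i ≤ B
    sparse-block with length*min-≤-sum (codegree inBlock? (pairs H)) Fin.zero (List.tabulate Fin.suc)
    ... | i , h = i , (begin
      suc m * codegree inBlock? (pairs H) i
        ≡⟨ cong (_* codegree inBlock? (pairs H) i) (Listₚ.length-tabulate {n = suc m} (λ j → j)) ⟨
      length (allFin (suc m)) * codegree inBlock? (pairs H) i          ≤⟨ h ⟩
      sum (map (codegree inBlock? (pairs H)) (allFin (suc m)))         ≡⟨ double-count inBlock? (pairs H) (allFin (suc m)) ⟨
      sum (map (degree inBlock? (allFin (suc m))) (pairs H))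
        ≤⟨ sum-map-≤ (pairs H) (All.tabulate λ {xy} _ → one xy) ⟩
      sum (map (λ _ → 1) (pairs H))                                    ≡⟨ sum-map-const 1 (pairs H) ⟩
      length (pairs H) * 1                                             ≡⟨ *-identityʳ _ ⟩
      length (pairs H)                                                 ≡⟨ length-pairs H ⟩
      size H                                                           ≤⟨ H≤B ⟩
      B                                                                ∎)
      where
      open ≤-Reasoning
      one : ∀ xy → degree inBlock? (allFin (suc m)) xy ≤ 1
      one xy = unique-subsingleton (Uniqueₚ.filter⁺ (inBlock? xy) (Uniqueₚ.allFin⁺ (suc m)))
        (Allₚ.all-filter (inBlock? xy) (allFin (suc m)))
        λ p q → Finₚ.toℕ-injective (trans (sym p) q)

    private
      i₀ = proj₁ sparse-block
      ψψ : Fin n × Fin n → Fin n × Fin n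
      ψψ (x , y) = ψ x , ψ y
      H₀ = filter (λ xy → inBlock? xy i₀) (pairs H)
      jumps = map ψψ H₀

    -- The walk never leaves block `i₀`. An edge of `Γ` unfolds into at most `K` edges of `R`, an
    -- edge of `H` into a jump.
    project-walk : ∀ {d x y} → blk x ≡ toℕ i₀ → Within ⟦ Γ ∪ᴾ H ⟧ d x y → Route R jumps (d * K) (ψ x) (ψ y)
    project-walk e stay = done
    project-walk {suc d} {x} e (step {v = z} r p) with Subsetₚ.x∈p∪q⁻ (codes Γ) (codes H) r
    ... | inj₁ r′ with e′ , q ← relationGraph⁻ copies? r′ =
      route-trans (within⇒route q) (project-walk (trans (sym e′) e) p)
    -- The jump is free, so the allowance of `K` for this hop remains unspent.
    ... | inj₂ r′ = route-mono (m≤n+m _ K) (jump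
      (∈ₚ.∈-map⁺ ψψ (∈ₚ.∈-filter⁺ (λ xy → inBlock? xy i₀) (∈-pairs⁺ {E = H} r′) e))
      (project-walk (trans (sym (proj₁ (copies-sound (H⊆Γ* r′)))) e) p))

    -- The three summands pay for reaching the first relay, for `D` hops inside the sparse copy, and
    -- for leaving the last relay.
    route-through : Star R ⇒ Route R jumps (K + (D * K + K))
    route-through {u} {v} p with _ , q ← star⇒within p with relayed _ ≤-refl q
    ... | inj₁ q′ = route-mono (m≤m+n K _) (within⇒route q′)
    ... | inj₂ (t , t′ , q₁ , s , q₂) = route-trans (within⇒route q₁) (route-trans mid (within⇒route q₂))
      where
      lift : Star Near t t′ → Star ⟦ Γ ⟧ (rep i₀ t) (rep i₀ t′)
      lift = Star.gmap (rep i₀) λ {a} {c} near → relationGraph⁺ copies?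
        ( trans (blk-rep i₀ a) (sym (blk-rep i₀ c))
        , subst₂ (Within R K) (sym (ψ-rep i₀ a)) (sym (ψ-rep i₀ c)) near)
      mid : Route R jumps (D * K) (S t) (S t′)
      mid = subst₂ (Route R jumps (D * K)) (ψ-rep i₀ t) (ψ-rep i₀ t′)
        (project-walk (blk-rep i₀ t) (short (lift s)))

    sparse-routing : Σ (List (Fin n × Fin n)) λ J → suc m * length J ≤ B ×
                     All (uncurry (Star R)) J × (Star R ⇒ Route R J (K + (D * K + K)))
    sparse-routing = jumps
      , ≤-trans (≤-reflexive (cong (suc m *_) (Listₚ.length-map ψψ H₀))) (proj₂ sparse-block)
      , Allₚ.map⁺ (All.tabulate λ { {x , y} xy∈ →
          proj₂ (copies-sound (H⊆Γ* (∈-pairs⁻ H (proj₁ (∈ₚ.∈-filter⁻ (λ xy → inBlock? xy i₀) {xs = pairs H} xy∈))))) })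
      , route-through

module _ {A : Set} {R : Rel A 0ℓ} {J : List (A × A)} where

  routeEdges : ∀ {k u v} → Route R J k u v → List (A × A)
  routeEdges done                         = []
  routeEdges (edge {u = u} {v = v} _ p)   = (u , v) ∷ routeEdges p
  routeEdges (jump _ p)                   = routeEdges p

  length-routeEdges : ∀ {k u v} (p : Route R J k u v) → length (routeEdges p) ≤ k
  length-routeEdges done       = z≤n
  length-routeEdges (edge _ p) = s≤s (length-routeEdges p)
  length-routeEdges (jump _ p) = length-routeEdges p

  routeEdges-sound : ∀ {k u v} (p : Route R J k u v) → All (uncurry R) (routeEdges p)
  routeEdges-sound done       = []
  routeEdges-sound (edge r p) = r ∷ routeEdges-sound p
  routeEdges-sound (jump _ p) = routeEdges-sound p

  follow : ∀ {T : Rel A 0ℓ} {k u v} (p : Route R J k u v) →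
           All (uncurry T) (routeEdges p) → All (uncurry (Star T)) J → Star T u v
  follow done       _        _  = ε
  follow (edge _ p) (t ∷ ts) js = t ◅ follow p ts js
  follow (jump j p) ts       js = All.lookup js j ◅◅ follow p ts js

  -- The relation `T` is left open because the final graph also contains the edges of later rounds,
  -- which realise the jumps of `J`.
  routes : ∀ {k} (Q : List (A × A)) → All (uncurry (Route R J k)) Q →
           Σ (List (A × A)) λ es → length es ≤ length Q * k × All (uncurry R) es ×
           (∀ {T : Rel A 0ℓ} → All (uncurry T) es → All (uncurry (Star T)) J → All (uncurry (Star T)) Q)
  routes []      []       = [] , z≤n , [] , λ _ _ → []
  routes {k} (q ∷ Q) (p ∷ ps) =
    let es , le , sound , join = routes Q ps
    in routeEdges p ++ es
     , ≤-trans (≤-reflexive (Listₚ.length-++ (routeEdges p))) (+-mono-≤ (length-routeEdges p) le)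
     , Allₚ.++⁺ (routeEdges-sound p) sound
     , λ ts js → follow p (Allₚ.++⁻ˡ (routeEdges p) ts) js ∷ join (Allₚ.++⁻ʳ (routeEdges p) ts) js

m<[1+m/n]*n : ∀ m n .{{_ : NonZero n}} → m < suc (m / n) * n
m<[1+m/n]*n m n = begin-strict
  m                      ≡⟨ m≡m%n+[m/n]*n m n ⟩
  m % n + m / n * n      <⟨ +-monoˡ-< (m / n * n) (m%n<n m n) ⟩
  suc (m / n) * n        ∎
  where open ≤-Reasoning

module _ {n} {R : Rel (Fin n) 0ℓ} (R? : Decidable₂ R) where

  onWalk? : ∀ k (uw : Fin n × Fin n) v → Dec (OnWalk {R = R} k (proj₁ uw) (proj₂ uw) v)
  onWalk? k (u , w) v = Finₚ.any? λ i → within? R? (suc (toℕ i)) u v ×-dec within? R? (k ∸ suc (toℕ i)) v w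

  -- The objects to hit are the pairs at distance exactly `suc k`. There are at most n² of them, and
  -- by `geodesic` each is met by at least `suc k` vertices.
  geodesics-hit : ∀ {k s t b} → n * n < 2 ^ s → suc k < n → n ≤ t * suc k + suc k → t * s ≤ b →
                  Σ (Vec (Fin n) b) λ S → ∀ {u w} → Within R (suc k) u w → ¬ Within R k u w →
                  ∃ λ i → OnWalk {R = R} (suc k) u w (Vec.lookup S i)
  geodesics-hit {k} {s} {t} n²<2^s K<n n≤ ts≤b =
    let S , hit = hitting-set (onWalk? (suc k)) {a = n ∸ suc k} {s = s} {t = t} far heavy
          (sym (m∸n+n≡m (<⇒≤ K<n))) (m<n⇒0<n∸m K<n)
          (≤-trans (∸-monoˡ-≤ (suc k) n≤) (≤-reflexive (m+n∸n≡m (t * suc k) (suc k))))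
          (≤-<-trans (≤-trans (Listₚ.length-filter far? allPairs) (≤-reflexive (length-allPairs {n}))) n²<2^s)
          ts≤b
    in S , λ p ¬q → hit (∈ₚ.∈-filter⁺ far? (∈-allPairs _ _) (p , ¬q))
    where
    far? : Decidable {A = Fin n × Fin n} (λ (u , w) → Within R (suc k) u w × ¬ Within R k u w)
    far? (u , w) = within? R? (suc k) u w ×-dec ¬? (within? R? k u w)
    far = filter far? allPairs
    heavy : All (Heavy (onWalk? (suc k)) (suc k)) far
    heavy = All.map (λ {uw} (p , ¬q) → let f , inj , on = geodesic p ¬q in
                      ≤-length-filter (onWalk? (suc k) uw) f inj on)
                    (Allₚ.all-filter far? allPairs)

  routing : ∀ {B D} → ShortcutsExist n B D → ∀ M s .{{_ : NonZero M}} .{{_ : NonZero s}} →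
            n * n < 2 ^ s → M * s < n →
            Σ (List (Fin n × Fin n)) λ J → M * length J ≤ B ×
            All (uncurry (Star R)) J × (Star R ⇒ Route R J (M * s + (D * (M * s) + M * s)))
  routing shortcuts M@(suc m) s@(suc s′) n²<2^s K<n =
    sparse-routing R? (Vec.lookup (proj₁ hitting)) (proj₂ hitting) blk ψ rep blk-rep ψ-rep shortcuts
    where
    -- With `b` relays per copy, `M` copies fit on `n` vertices. The greedy choice halves the unhit
    -- pairs every `t` choices, and `s` halvings fit into `b`.
    b = n / M
    t = b / s
    instance
      b≢0 : NonZero b
      b≢0 = >-nonZero (m≥n⇒m/n>0 (≤-trans (m≤m*n M s) (<⇒≤ K<n)))
    -- Rounding down twice loses less than one `M * s` in total.
    n≤ : n ≤ t * (M * s) + M * s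
    n≤ = begin
      n                          ≤⟨ <⇒≤ (m<[1+m/n]*n n M) ⟩
      suc b * M                  ≤⟨ *-monoˡ-≤ M (m<[1+m/n]*n b s) ⟩
      suc t * s * M              ≡⟨ rearrange t s M ⟩
      t * (M * s) + M * s        ∎
      where
      open ≤-Reasoning
      rearrange : ∀ t s M → suc t * s * M ≡ t * (M * s) + M * s
      rearrange = solve-∀
    hitting = geodesics-hit {s = s} {t = t} {b = b} n²<2^s K<n n≤ (m/n*n≤m b s)
    -- Copy `i` occupies the positions from `i * b` to `i * b + b - 1`, so quotient and remainder by
    -- `b` recover copy and relay. Positions from `M * b` on fall into blocks that are never
    -- selected.
    blk : Fin n → ℕ
    blk x = toℕ x / b
    ψ : Fin n → Fin n
    ψ x = Vec.lookup (proj₁ hitting) (toℕ x mod b)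
    M*b≤n : M * b ≤ n
    M*b≤n = ≤-trans (≤-reflexive (*-comm M b)) (m/n*n≤m n M)
    rep : Fin M → Fin b → Fin n
    rep i j = Fin.inject≤ (Fin.combine i j) M*b≤n
    toℕ-rep : ∀ i j → toℕ (rep i j) ≡ toℕ j + toℕ i * b
    toℕ-rep i j = trans (Finₚ.toℕ-inject≤ (Fin.combine i j) M*b≤n)
      (trans (Finₚ.toℕ-combine i j) (trans (+-comm (b * toℕ i) (toℕ j)) (cong (toℕ j +_) (*-comm b (toℕ i)))))
    blk-rep : ∀ i j → blk (rep i j) ≡ toℕ i
    blk-rep i j = trans (cong (_/ b) (toℕ-rep i j)) (trans (+-distrib-/-∣ʳ (toℕ j) (divides-refl (toℕ i)))
      (cong₂ _+_ (m<n⇒m/n≡0 (Finₚ.toℕ<n j)) (m*n/n≡m (toℕ i) b)))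
    rep-mod : ∀ i j → toℕ (rep i j) mod b ≡ j
    rep-mod i j = Finₚ.toℕ-injective (trans (Finₚ.toℕ-fromℕ< _)
      (trans (cong (_% b) (toℕ-rep i j)) (trans ([m+kn]%n≡m%n (toℕ j) (toℕ i) b) (m<n⇒m%n≡m (Finₚ.toℕ<n j)))))
    ψ-rep : ∀ i j → ψ (rep i j) ≡ Vec.lookup (proj₁ hitting) j
    ψ-rep i j = cong (Vec.lookup (proj₁ hitting)) (rep-mod i j)

-- Sparse preservers and the hard graph

reachable? : ∀ {n} {R : Rel (Fin n) 0ℓ} → Decidable₂ R → Decidable₂ (Star R)
reachable? {n} R? u v = map′ within⇒star (λ p → within-shrink R? ≤-refl _ (proj₂ (star⇒within p))) (within? R? n u v)

-- Routes get longer in proportion to `M`, but the pairs get fewer in the same proportion, so the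
-- cost of a round does not depend on `M`.
level-cost : ∀ M q s c {B D} → M * q ≤ 2 * B → c ≤ 3 * D * (M * s) → q * c ≤ 2 * B * (3 * D * s)
level-cost M q s c {B} {D} Mq≤2B c≤ = begin
  q * c                    ≤⟨ *-monoʳ-≤ q c≤ ⟩
  q * (3 * D * (M * s))    ≡⟨ rearrange M q s D ⟩
  M * q * (3 * D * s)      ≤⟨ *-monoˡ-≤ (3 * D * s) Mq≤2B ⟩
  2 * B * (3 * D * s)      ∎
  where
  open ≤-Reasoning
  rearrange : ∀ M q s D → q * (3 * D * (M * s)) ≡ M * q * (3 * D * s)
  rearrange = solve-∀

three-legs : ∀ {D} K → 1 ≤ D → K + (D * K + K) ≤ 3 * D * K
three-legs {D} K 1≤D = begin
  K + (D * K + K)                ≡⟨ rearrange D K ⟩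
  1 * K + D * K + 1 * K          ≤⟨ +-mono-≤ (+-monoˡ-≤ (D * K) (*-monoˡ-≤ K 1≤D)) (*-monoˡ-≤ K 1≤D) ⟩
  D * K + D * K + D * K          ≡⟨ rearrange′ D K ⟩
  3 * D * K                      ∎
  where
  open ≤-Reasoning
  rearrange : ∀ D K → K + (D * K + K) ≡ 1 * K + D * K + 1 * K
  rearrange = solve-∀
  rearrange′ : ∀ D K → D * K + D * K + D * K ≡ 3 * D * K
  rearrange′ = solve-∀

module _ {n} {R : Rel (Fin n) 0ℓ} (R? : Decidable₂ R) {B D s} .{{_ : NonZero s}}
         (shortcuts : ShortcutsExist n B D) (1≤D : 1 ≤ D) (n²<2^s : n * n < 2 ^ s) where

  -- Round `j` works with M = 2^j and at most `r` rounds follow. The invariant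
  -- `2 ^ j * length Q ≤ 2 * B` keeps the cost of each round constant.
  preserve : ∀ r j → n < 2 ^ (j + r) → ∀ Q → All (uncurry (Star R)) Q → 2 ^ j * length Q ≤ 2 * B →
             Σ (List (Fin n × Fin n)) λ es → length es ≤ suc r * (2 * B * (3 * D * s)) ×
             All (uncurry R) es × All (uncurry (Star (λ u v → (u , v) ∈ es))) Q
  preserve r j n<2^ Q Q⊆ MQ≤2B with n ≤? 2 ^ j * s
  -- Walks of at most `K` edges now realise all of reachability, so the last round needs no jumps.
  ... | yes n≤K =
    let es , le , sound , join = routes Q (All.map (λ p → within⇒route {J = []} (within-shrink R? n≤K _ (proj₂ (star⇒within p)))) Q⊆)
    in es
     , ≤-trans le (≤-trans (level-cost (2 ^ j) (length Q) s _ {B} {D} MQ≤2B (≤-trans (m≤m+n _ _) (three-legs (2 ^ j * s) 1≤D)))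
                           (m≤m+n _ _))
     , sound
     , join (All.tabulate (λ e∈ → e∈)) []
  preserve zero j n<2^ Q Q⊆ MQ≤2B | no n≰K = contradiction
    (≤-trans (<⇒≤ n<2^) (≤-trans (≤-reflexive (cong (2 ^_) (+-identityʳ j))) (m≤m*n (2 ^ j) s))) n≰K
  preserve (suc r) j n<2^ Q Q⊆ MQ≤2B | no n≰K
    with J , MJ≤B , J⊆ , route ← routing R? shortcuts (2 ^ j) s {{m^n≢0 2 j}} n²<2^s (≰⇒> n≰K)
    with es₁ , le₁ , sound₁ , join ← routes Q (All.map (λ p → route p) Q⊆)
    -- The jumps become the next pairs to connect; the bound `B` on `2 ^ j * length J` is the
    -- invariant for the doubled M.
    with es₂ , le₂ , sound₂ , J* ← preserve r (suc j) (subst (λ e → n < 2 ^ e) (+-suc j r) n<2^) J J⊆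
           (≤-trans (≤-reflexive (*-assoc 2 (2 ^ j) (length J))) (*-monoʳ-≤ 2 MJ≤B))
    = es₁ ++ es₂
    , ≤-trans (≤-reflexive (Listₚ.length-++ es₁))
        (+-mono-≤ (≤-trans le₁ (level-cost (2 ^ j) (length Q) s _ {B} {D} MQ≤2B (three-legs (2 ^ j * s) 1≤D))) le₂)
    , Allₚ.++⁺ sound₁ sound₂
    , join (All.tabulate (∈ₚ.∈-++⁺ˡ)) (All.map (Star.map (∈ₚ.∈-++⁺ʳ es₁)) J*)

TC⇒Star : ∀ {n} {G : Digraph n} → TC G ⇒ Star ⟦ G ⟧
TC⇒Star [ r ]   = r ◅ ε
TC⇒Star (r ∷ p) = r ◅ TC⇒Star p

◅⇒TC : ∀ {n} {G : Digraph n} {u v w} → ⟦ G ⟧ u v → Star ⟦ G ⟧ v w → TC G u w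
◅⇒TC r ε        = [ r ]
◅⇒TC r (r′ ◅ p) = r ∷ ◅⇒TC r′ p

sparse-preserver : ∀ {n B D L s} .{{_ : NonZero s}} → ShortcutsExist n B D → 1 ≤ D →
                   n < 2 ^ L → n * n < 2 ^ s → (G : Digraph n) (P : PairSet n) → size P ≤ 2 * B →
                   Σ (Digraph n) λ G′ → IsPreserver G P G′ × size G′ ≤ suc L * (2 * B * (3 * D * s))
sparse-preserver {n} {B} {D} {L} {s} shortcuts 1≤D n<2^L n²<2^s G P P≤2B
  with es , le , sound , Q* ← preserve (adjacent? G) shortcuts 1≤D n²<2^s L 0 n<2^L
         -- Pairs of `P` that are not reachable in `G` demand nothing. At `j = 0` the invariant is
         -- the bound on `size P`.
         (filter (uncurry (reachable? (adjacent? G))) (pairs P))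
         (Allₚ.all-filter (uncurry (reachable? (adjacent? G))) (pairs P))
         (≤-trans (≤-reflexive (*-identityˡ _)) (≤-trans (Listₚ.length-filter (uncurry (reachable? (adjacent? G))) (pairs P))
           (≤-trans (≤-reflexive (length-pairs P)) P≤2B)))
  = fromPairs es
  , record
    { subgraph = λ e → All.lookup sound (fromPairs⁻ es e)
    ; reaches  = λ p uv∈P → Star.map fromPairs⁺ (All.lookup Q*
        (∈ₚ.∈-filter⁺ (uncurry (reachable? (adjacent? G))) (∈-pairs⁺ {E = P} uv∈P) (TC⇒Star p)))
    }
  , ≤-trans (size-fromPairs es) le

⇒? : ∀ {n} {R S : Rel (Fin n) 0ℓ} → Decidable₂ R → Decidable₂ S → Dec (R ⇒ S)
⇒? R? S? = map′ (λ f {u} {v} → f u v) (λ f u v → f)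
  (Finₚ.all? λ u → Finₚ.all? λ v → R? u v →-dec S? u v)

hasShortcut? : ∀ {n} B D (Γ : Digraph n) → Dec (HasShortcut B D Γ)
hasShortcut? B D Γ = map′ (λ (c , h) → pairSet c , h) (λ (H , h) → codes H , h)
  (Subsetₚ.anySubset? λ c → let H = pairSet c in
    size H ≤? B ×-dec ⇒? (adjacent? H) (reachable? (adjacent? Γ))
                ×-dec ⇒? (reachable? (adjacent? Γ)) (within? (adjacent? (Γ ∪ᴾ H)) D))

-- Graphs and candidate shortcuts on `n` vertices are finite in number, so both quantifiers can be
-- decided by exhaustion.
shortcuts-or-not : ∀ n B D → ShortcutsExist n B D ⊎ Σ (Digraph n) λ Γ → ¬ HasShortcut B D Γ
shortcuts-or-not n B D with Subsetₚ.anySubset? (λ c → ¬? (hasShortcut? {n} B D (pairSet c)))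
... | yes (c , ¬h) = inj₂ (pairSet c , ¬h)
... | no ¬∃        = inj₁ λ Γ → decidable-stable (hasShortcut? B D Γ) λ ¬h → ¬∃ (codes Γ , ¬h)

shortcutsExist-n : ∀ n B → ShortcutsExist n B n
shortcutsExist-n n B Γ = pairSet Subset.⊥ , ≤-trans (≤-reflexive (Subsetₚ.∣⊥∣≡0 (n * n))) z≤n
  , (λ h → contradiction h Subsetₚ.∉⊥)
  , λ p → within-map (λ r → Subsetₚ.x∈p∪q⁺ (inj₁ r))
      (within-shrink (adjacent? Γ) ≤-refl _ (proj₂ (star⇒within p)))

-- In the complete graph, joining two distinct vertices takes a hop.
¬shortcutsExist-0 : ∀ {n} B → 2 ≤ n → ¬ ShortcutsExist n B 0
¬shortcutsExist-0 {suc (suc n)} B _ shortcuts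
  with proj₂ (proj₂ (proj₂ (shortcuts (pairSet Subset.⊤)))) {Fin.zero} {Fin.suc Fin.zero} (Subsetₚ.∈⊤ ◅ ε)
... | ()
¬shortcutsExist-0 {suc zero} B (s≤s ()) _

path⇒within : ∀ {n} {G : Digraph n} {u v} (p : Path G u v) → Within ⟦ G ⟧ (hops p) u v
path⇒within ε       = stay
path⇒within (r ◅ p) = step r (path⇒within p)

isShortcut⇒hasShortcut : ∀ {n B d D} {G : Digraph n} {H} → IsShortcut d G H → size H ≤ B → d ≤ D → HasShortcut B D G
isShortcut⇒hasShortcut {D = D} {G} {H} sc H≤B d≤D = H , H≤B , (λ h → TC⇒Star (inTC h)) , short′
  where
  open IsShortcut sc
  short′ : Star ⟦ G ⟧ ⇒ Within ⟦ G ∪ᴾ H ⟧ D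
  short′ ε       = stay
  short′ (r ◅ p) = let π , le = short (◅⇒TC r p) in within-mono (≤-trans le d≤D) (path⇒within π)

-- The search descends from `n`, where the empty shortcut suffices, to the first failure, which
-- comes at 0 at the latest. The graph that fails there is hard, while one more hop serves every
-- graph.
hardest : ∀ {n} B → 2 ≤ n → Σ (Digraph n) λ G → ∃ λ D → 1 ≤ D × ShortcutsExist n B D ×
          (∀ d H → IsShortcut d G H → size H ≤ B → D ≤ d)
hardest {n} B 2≤n = search n (shortcutsExist-n n B)
  where
  search : ∀ D → ShortcutsExist n B D → Σ (Digraph n) λ G → ∃ λ D → 1 ≤ D × ShortcutsExist n B D ×
           (∀ d H → IsShortcut d G H → size H ≤ B → D ≤ d)
  search zero    all = contradiction all (¬shortcutsExist-0 B 2≤n)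
  search (suc D) all with shortcuts-or-not n B D
  ... | inj₁ all′     = search D all′
  ... | inj₂ (G , ¬h) = G , suc D , s≤s z≤n , all , λ d H sc H≤B →
    ≰⇒> λ d≤D → ¬h (isShortcut⇒hasShortcut sc H≤B d≤D)

-- Logarithms and powers

open import Data.Integer using (+_)

lg : ℕ → ℕ
lg zero    = zero
lg (suc n) with 2 ^ suc (lg n) ≤? suc n
... | yes _ = suc (lg n)
... | no  _ = lg n

n<2^[1+lg] : ∀ n → n < 2 ^ suc (lg n)
n<2^[1+lg] zero    = s≤s z≤n
n<2^[1+lg] (suc n) with 2 ^ suc (lg n) ≤? suc n
... | yes _ = ≤-trans (s≤s (n<2^[1+lg] n)) (+-mono-≤ (m^n>0 2 (suc (lg n))) (≤-reflexive (sym (+-identityʳ _))))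
... | no ¬p = ≰⇒> ¬p

2^lg≤n : ∀ n → 2 ^ lg (suc n) ≤ suc n
2^lg≤n zero    = s≤s z≤n
2^lg≤n (suc n) with 2 ^ suc (lg (suc n)) ≤? suc (suc n)
... | yes p = p
... | no  _ = ≤-trans (2^lg≤n n) (n≤1+n _)

≤-lg : ∀ {m n} → 2 ^ m ≤ n → m ≤ lg n
≤-lg {m} {n} 2^m≤n = s≤s⁻¹ (^-cancel-< (≤-<-trans 2^m≤n (n<2^[1+lg] n)))
  where
  ^-cancel-< : ∀ {a b} → 2 ^ a < 2 ^ b → a < b
  ^-cancel-< h = ≰⇒> λ b≤a → <⇒≱ h (^-monoʳ-≤ 2 b≤a)

1+n≤2^n : ∀ n → suc n ≤ 2 ^ n
1+n≤2^n zero    = s≤s z≤n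
1+n≤2^n (suc n) = ≤-trans (≤-reflexive (+-comm 1 (suc n)))
  (+-mono-≤ (1+n≤2^n n) (≤-trans (m^n>0 2 n) (≤-reflexive (sym (+-identityʳ _)))))

-- For d = 0 this is A (1 + 3 A) ≤ (1 + A)³.
linear≤exponential : ∀ A d → A * suc (3 * A + d) ≤ 2 ^ (3 * A + d)
linear≤exponential A zero = begin
  A * suc (3 * A + 0)                      ≤⟨ m≤m+n _ (1 + 2 * A + A * A * A) ⟩
  A * suc (3 * A + 0) + (1 + 2 * A + A * A * A) ≡⟨ rearrange A ⟩
  suc A * (suc A * (suc A * 1))            ≤⟨ ^-monoˡ-≤ 3 (1+n≤2^n A) ⟩
  (2 ^ A) ^ 3                              ≡⟨ ^-*-assoc 2 A 3 ⟩
  2 ^ (A * 3)                              ≡⟨ cong (2 ^_) (trans (*-comm A 3) (sym (+-identityʳ (3 * A)))) ⟩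
  2 ^ (3 * A + 0)                          ∎
  where
  open ≤-Reasoning
  rearrange : ∀ A → A * suc (3 * A + 0) + (1 + 2 * A + A * A * A) ≡ suc A * (suc A * (suc A * 1))
  rearrange = solve-∀
linear≤exponential A (suc d) = begin
  A * suc (3 * A + suc d)                  ≡⟨ rearrange A d ⟩
  A * suc (3 * A + d) + A                  ≤⟨ +-mono-≤ (linear≤exponential A d) small ⟩
  2 ^ (3 * A + d) + 2 ^ (3 * A + d)        ≡⟨ cong (λ y → 2 ^ (3 * A + d) + y) (sym (+-identityʳ (2 ^ (3 * A + d)))) ⟩
  2 ^ suc (3 * A + d)                      ≡⟨ cong (2 ^_) (+-suc (3 * A) d) ⟨
  2 ^ (3 * A + suc d)                      ∎
  where
  open ≤-Reasoning
  rearrange : ∀ A d → A * suc (3 * A + suc d) ≡ A * suc (3 * A + d) + A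
  rearrange = solve-∀
  small : A ≤ 2 ^ (3 * A + d)
  small = ≤-trans (≤-trans (n≤1+n A) (1+n≤2^n A)) (^-monoʳ-≤ 2 (≤-trans (m≤n*m A 3) (m≤m+n (3 * A) d)))

-- The loss between `D * n` and `k` times the size of the preserver. The constant is 24 = 2 · 2 · 3
-- · 2, the first factor from `suc L ≤ L + L`.
polylog : ℕ → ℕ → ℕ
polylog k n = 24 * k * suc (lg n) ^ 3

-- A bound for the binary logarithm of `polylog`: 24 ≤ 2^5, k ≤ 2^k, and the cube of L = 1 + ⌊log₂
-- n⌋ gives the last summand. It grows like log log n.
polylog-exponent : ℕ → ℕ → ℕ
polylog-exponent k n = 5 + k + 3 * suc (lg (suc (lg n)))

polylog≤2^ : ∀ k n → polylog k n ≤ 2 ^ polylog-exponent k n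
polylog≤2^ k n = begin
  24 * k * L ^ 3                       ≤⟨ *-mono-≤ (*-mono-≤ (m≤m+n 24 8) (≤-trans (n≤1+n k) (1+n≤2^n k)))
                                                     (^-monoˡ-≤ 3 (<⇒≤ (n<2^[1+lg] L))) ⟩
  2 ^ 5 * 2 ^ k * (2 ^ x) ^ 3          ≡⟨ cong₂ _*_ (sym (^-distribˡ-+-* 2 5 k)) (trans (^-*-assoc 2 x 3) (cong (2 ^_) (*-comm x 3))) ⟩
  2 ^ (5 + k) * 2 ^ (3 * x)            ≡⟨ ^-distribˡ-+-* 2 (5 + k) (3 * x) ⟨
  2 ^ (5 + k + 3 * x)                  ∎
  where
  open ≤-Reasoning
  L = suc (lg n)
  x = suc (lg L)

-- The factor 2 in the exponent comes from 2 ^ (1 + lg n) ≤ 2 n ≤ n ².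
polylog^≤n^ : ∀ k n → 2 ≤ n → polylog k n ^ suc (lg n) ≤ n ^ (2 * polylog-exponent k n)
polylog^≤n^ k n@(suc n-1) 2≤n = begin
  polylog k n ^ L        ≤⟨ ^-monoˡ-≤ L (polylog≤2^ k n) ⟩
  (2 ^ w) ^ L            ≡⟨ trans (^-*-assoc 2 w L) (trans (cong (2 ^_) (*-comm w L)) (sym (^-*-assoc 2 L w))) ⟩
  (2 ^ L) ^ w            ≤⟨ ^-monoˡ-≤ w (*-mono-≤ 2≤n (2^lg≤n n-1)) ⟩
  (n * n) ^ w            ≡⟨ cong (_^ w) (cong (n *_) (sym (*-identityʳ n))) ⟩
  (n ^ 2) ^ w            ≡⟨ ^-*-assoc n 2 w ⟩
  n ^ (2 * w)            ∎
  where
  open ≤-Reasoning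
  L = suc (lg n)
  w = polylog-exponent k n

polylog-exponent-small : ∀ k b → ∃ λ N → ∀ n → N ≤ n → 2 * polylog-exponent k n * b ≤ suc (lg n)
-- The double exponential makes x = `lg (suc (lg n))` at least `3 * A`, where `linear≤exponential`
-- applies.
polylog-exponent-small k b = 2 ^ 2 ^ (3 * A) , λ n N≤n → bound n (≤-trans (≤-lg N≤n) (n≤1+n _))
  where
  open ≤-Reasoning
  A = 2 * b * (8 + k)
  bound : ∀ n → 2 ^ (3 * A) ≤ suc (lg n) → 2 * polylog-exponent k n * b ≤ suc (lg n)
  bound n h with d , eq ← m≤n⇒∃[o]m+o≡n (≤-lg h) = begin
    2 * (5 + k + 3 * suc x) * b                          ≤⟨ m≤m+n _ (2 * (5 + k) * x * b) ⟩
    2 * (5 + k + 3 * suc x) * b + 2 * (5 + k) * x * b    ≡⟨ rearrange k b x ⟩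
    A * suc x                                            ≡⟨ cong (λ y → A * suc y) (sym eq) ⟩
    A * suc (3 * A + d)                                  ≤⟨ linear≤exponential A d ⟩
    2 ^ (3 * A + d)                                      ≡⟨ cong (2 ^_) eq ⟩
    2 ^ x                                                ≤⟨ 2^lg≤n (lg n) ⟩
    suc (lg n)                                           ∎
    where
    x = lg (suc (lg n))
    rearrange : ∀ k b x → 2 * (5 + k + 3 * suc x) * b + 2 * (5 + k) * x * b ≡ 2 * b * (8 + k) * suc x
    rearrange = solve-∀

preserver-size≤polylog : ∀ k n D → let L = suc (lg n) in
  k * (suc L * (2 * (L * n) * (3 * D * (L + L)))) ≤ polylog k n * D * n
preserver-size≤polylog k n D = begin
  k * (suc L * (2 * (L * n) * (3 * D * (L + L))))
    ≤⟨ *-monoʳ-≤ k (*-monoˡ-≤ (2 * (L * n) * (3 * D * (L + L))) (+-monoˡ-≤ L (s≤s (z≤n {lg n})))) ⟩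
  k * ((L + L) * (2 * (L * n) * (3 * D * (L + L))))
    ≡⟨ rearrange k L n D ⟩
  24 * k * (L * (L * (L * 1))) * D * n    ∎
  where
  open ≤-Reasoning
  L = suc (lg n)
  rearrange : ∀ k L n D → k * ((L + L) * (2 * (L * n) * (3 * D * (L + L)))) ≡ 24 * k * (L * (L * (L * 1))) * D * n
  rearrange = solve-∀

^-cancelˡ-≤ : ∀ {a b} k .{{_ : NonZero k}} → a ^ k ≤ b ^ k → a ≤ b
^-cancelˡ-≤ k h = ≮⇒≥ λ b<a → <⇒≱ (^-monoˡ-< k b<a) h

-- The last hypothesis is c/Q + 1 + e/L ≤ (x - y)/M, with c = c⁺ - c⁻, cleared of
-- denominators and of subtraction.
extract-power : ∀ n W D x y c⁺ c⁻ M Q L e .{{_ : NonZero n}} .{{_ : NonZero M}} .{{_ : NonZero L}} →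
  n ^ x ≤ (W * D * n) ^ M * n ^ y → W ^ L ≤ n ^ e →
  c⁺ * (L * M) + ((L + e) * (Q * M) + y * (Q * L)) ≤ x * (Q * L) + c⁻ * (L * M) →
  n ^ c⁺ ≤ D ^ Q * n ^ c⁻
extract-power n W D x y c⁺ c⁻ M Q L e hyp W^L≤n^e exponents =
  -- The power `L * M` makes all the roots integral, and the common factor `n ^ z` stands in for
  -- subtracting exponents.
  ^-cancelˡ-≤ (L * M) {{m*n≢0 L M}} (*-cancelʳ-≤ _ _ (n ^ z) {{m^n≢0 n z}} (begin
    (n ^ c⁺) ^ (L * M) * n ^ z           ≡⟨ cong (_* n ^ z) (^-*-assoc n c⁺ (L * M)) ⟩
    n ^ (c⁺ * (L * M)) * n ^ z           ≡⟨ ^-distribˡ-+-* n (c⁺ * (L * M)) z ⟨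
    n ^ (c⁺ * (L * M) + z)               ≤⟨ ^-monoʳ-≤ n exponents ⟩
    n ^ (x * (Q * L) + c⁻ * (L * M))     ≡⟨ ^-distribˡ-+-* n (x * (Q * L)) (c⁻ * (L * M)) ⟩
    n ^ (x * (Q * L)) * C                ≡⟨ cong (_* C) (sym (^-*-assoc n x (Q * L))) ⟩
    (n ^ x) ^ (Q * L) * C                ≤⟨ *-monoˡ-≤ C (^-monoˡ-≤ (Q * L) hyp) ⟩
    ((W * D * n) ^ M * n ^ y) ^ (Q * L) * C   ≡⟨ cong (_* C) expand ⟩
    W′ * D′ * n ^ (M * (Q * L)) * n ^ (y * (Q * L)) * C ≤⟨ *-monoˡ-≤ C (*-monoˡ-≤ _ (*-monoˡ-≤ _ (*-monoˡ-≤ D′ W′≤))) ⟩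
    n ^ (e * (Q * M)) * D′ * n ^ (M * (Q * L)) * n ^ (y * (Q * L)) * C
      ≡⟨ rearrange (n ^ (e * (Q * M))) D′ (n ^ (M * (Q * L))) (n ^ (y * (Q * L))) C ⟩
    D′ * C * (n ^ (M * (Q * L)) * n ^ (e * (Q * M)) * n ^ (y * (Q * L)))
      ≡⟨ cong₂ _*_ root collect ⟩
    (D ^ Q * n ^ c⁻) ^ (L * M) * n ^ z   ∎))
  where
  open ≤-Reasoning
  z = (L + e) * (Q * M) + y * (Q * L)
  C = n ^ (c⁻ * (L * M))
  W′ = W ^ (M * (Q * L))
  D′ = D ^ (M * (Q * L))
  rearrange : ∀ w d a b c → w * d * a * b * c ≡ d * c * (a * w * b)
  rearrange = solve-∀
  expand : ((W * D * n) ^ M * n ^ y) ^ (Q * L) ≡ W′ * D′ * n ^ (M * (Q * L)) * n ^ (y * (Q * L))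
  expand = trans (^-distribʳ-* ((W * D * n) ^ M) (n ^ y) (Q * L)) (cong₂ _*_
    (trans (^-*-assoc (W * D * n) M (Q * L)) (trans (^-distribʳ-* (W * D) n (M * (Q * L)))
      (cong (_* n ^ (M * (Q * L))) (^-distribʳ-* W D (M * (Q * L))))))
    (^-*-assoc n y (Q * L)))
  exponent₁ : ∀ M Q L → M * (Q * L) ≡ L * (Q * M)
  exponent₁ = solve-∀
  exponent₂ : ∀ M Q L → M * (Q * L) ≡ Q * (L * M)
  exponent₂ = solve-∀
  W′≤ : W′ ≤ n ^ (e * (Q * M))
  W′≤ = begin
    W ^ (M * (Q * L))   ≡⟨ trans (cong (W ^_) (exponent₁ M Q L)) (sym (^-*-assoc W L (Q * M))) ⟩
    (W ^ L) ^ (Q * M)   ≤⟨ ^-monoˡ-≤ (Q * M) W^L≤n^e ⟩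
    (n ^ e) ^ (Q * M)   ≡⟨ ^-*-assoc n e (Q * M) ⟩
    n ^ (e * (Q * M))   ∎
  root : D′ * C ≡ (D ^ Q * n ^ c⁻) ^ (L * M)
  root = trans (cong₂ _*_ (trans (cong (D ^_) (exponent₂ M Q L)) (sym (^-*-assoc D Q (L * M)))) (sym (^-*-assoc n c⁻ (L * M))))
    (sym (^-distribʳ-* (D ^ Q) (n ^ c⁻) (L * M)))
  collect : n ^ (M * (Q * L)) * n ^ (e * (Q * M)) * n ^ (y * (Q * L)) ≡ n ^ z
  collect = trans (cong (_* n ^ (y * (Q * L))) (sym (^-distribˡ-+-* n (M * (Q * L)) (e * (Q * M)))))
    (trans (sym (^-distribˡ-+-* n (M * (Q * L) + e * (Q * M)) (y * (Q * L))))
      (cong (λ v → n ^ (v + y * (Q * L))) (trans (cong (_+ e * (Q * M)) (exponent₁ M Q L)) (sym (*-distribʳ-+ (Q * M) L e)))))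

-- Real exponents

pos-part∸neg-part : ∀ z → z ≡ + (z ⁺) ℤ.- + (z ⁻)
pos-part∸neg-part (+ zero)    = refl
pos-part∸neg-part (+ suc n)   = sym (ℤₚ.+-identityʳ (+ suc n))
pos-part∸neg-part -[1+ n ]    = refl

-- The hypothesis has the form to which c/Q + (1/1 + e/L) ≤ (a + b)/M unfolds for unnormalised
-- fractions. Adding all negative parts, collected in `K`, to both sides leaves natural numbers.
clear-signs : ∀ c a b M Q L e →
  (c ℤ.* (+ 1 ℤ.* + L) ℤ.+ (+ 1 ℤ.* + L ℤ.+ + e ℤ.* + 1) ℤ.* + Q) ℤ.* + M ℤ.≤ (a ℤ.+ b) ℤ.* + (Q * (1 * L)) →
  c ⁺ * (L * M) + ((L + e) * (Q * M) + (a ⁻ + b ⁻) * (Q * L)) ≤ (a ⁺ + b ⁺) * (Q * L) + c ⁻ * (L * M)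
clear-signs c a b M Q L e h = ℤₚ.drop‿+≤+ (subst₂ ℤ._≤_ lhs rhs (ℤₚ.+-monoˡ-≤ K h))
  where
  K = + (c ⁻) ℤ.* (+ L ℤ.* + M) ℤ.+ (+ (a ⁻) ℤ.+ + (b ⁻)) ℤ.* (+ Q ℤ.* + L)
  pos-*₂ : ∀ x y z → + (x * (y * z)) ≡ + x ℤ.* (+ y ℤ.* + z)
  pos-*₂ x y z = trans (ℤₚ.pos-* x (y * z)) (cong (+ x ℤ.*_) (ℤₚ.pos-* y z))
  lhs : (c ℤ.* (+ 1 ℤ.* + L) ℤ.+ (+ 1 ℤ.* + L ℤ.+ + e ℤ.* + 1) ℤ.* + Q) ℤ.* + M ℤ.+ K ≡
        + (c ⁺ * (L * M) + ((L + e) * (Q * M) + (a ⁻ + b ⁻) * (Q * L)))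
  lhs = trans
    (trans (cong (λ z → (z ℤ.* (+ 1 ℤ.* + L) ℤ.+ (+ 1 ℤ.* + L ℤ.+ + e ℤ.* + 1) ℤ.* + Q) ℤ.* + M ℤ.+ K) (pos-part∸neg-part c))
      (rearrange (+ (c ⁺)) (+ (c ⁻)) (+ (a ⁻)) (+ (b ⁻)) (+ M) (+ Q) (+ L) (+ e)))
    (sym (cong₂ ℤ._+_ (pos-*₂ (c ⁺) L M) (cong₂ ℤ._+_ (pos-*₂ (L + e) Q M) (pos-*₂ (a ⁻ + b ⁻) Q L))))
    where
    rearrange : ∀ c⁺ c⁻ a⁻ b⁻ M Q L e →
      ((c⁺ ℤ.- c⁻) ℤ.* (+ 1 ℤ.* L) ℤ.+ (+ 1 ℤ.* L ℤ.+ e ℤ.* + 1) ℤ.* Q) ℤ.* M ℤ.+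
        (c⁻ ℤ.* (L ℤ.* M) ℤ.+ (a⁻ ℤ.+ b⁻) ℤ.* (Q ℤ.* L)) ≡
      c⁺ ℤ.* (L ℤ.* M) ℤ.+ ((L ℤ.+ e) ℤ.* (Q ℤ.* M) ℤ.+ (a⁻ ℤ.+ b⁻) ℤ.* (Q ℤ.* L))
    rearrange = ℤ-Solver.solve-∀
  rhs : (a ℤ.+ b) ℤ.* + (Q * (1 * L)) ℤ.+ K ≡ + ((a ⁺ + b ⁺) * (Q * L) + c ⁻ * (L * M))
  rhs = trans
    (trans (cong₂ (λ z w → z ℤ.* w ℤ.+ K) (cong₂ ℤ._+_ (pos-part∸neg-part a) (pos-part∸neg-part b)) (pos-*₂ Q 1 L))
      (rearrange (+ (a ⁺)) (+ (a ⁻)) (+ (b ⁺)) (+ (b ⁻)) (+ (c ⁻)) (+ M) (+ Q) (+ L)))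
    (sym (cong₂ ℤ._+_ (pos-*₂ (a ⁺ + b ⁺) Q L) (pos-*₂ (c ⁻) L M)))
    where
    rearrange : ∀ a⁺ a⁻ b⁺ b⁻ c⁻ M Q L →
      ((a⁺ ℤ.- a⁻) ℤ.+ (b⁺ ℤ.- b⁻)) ℤ.* (Q ℤ.* (+ 1 ℤ.* L)) ℤ.+ (c⁻ ℤ.* (L ℤ.* M) ℤ.+ (a⁻ ℤ.+ b⁻) ℤ.* (Q ℤ.* L)) ≡
      (a⁺ ℤ.+ b⁺) ℤ.* (Q ℤ.* L) ℤ.+ c⁻ ℤ.* (L ℤ.* M)
    rearrange = ℤ-Solver.solve-∀

_/suc_ : ℕ → ℕ → ℚ
e /suc ℓ = ℚ.fromℚᵘ (mkℚᵘ (+ e) ℓ)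

clear-denominators : ∀ q r s e ℓ → q ℚ.+ (1ℚ ℚ.+ e /suc ℓ) ℚ.≤ r ℚ.+ s →
  let Q = ↧ₙ q ; M = ↧ₙ r * ↧ₙ s ; L = suc ℓ ; a = ↥ r ℤ.* ↧ s ; b = ↥ s ℤ.* ↧ r in
  ((↥ q) ⁺) * (L * M) + ((L + e) * (Q * M) + (a ⁻ + b ⁻) * (Q * L)) ≤ (a ⁺ + b ⁺) * (Q * L) + ((↥ q) ⁻) * (L * M)
clear-denominators q@record{} r@record{} s@record{} e ℓ h =
  clear-signs (↥ q) (↥ r ℤ.* ↧ s) (↥ s ℤ.* ↧ r) (↧ₙ r * ↧ₙ s) (↧ₙ q) (suc ℓ) e
    (ℚᵘₚ.drop-*≤* (ℚᵘₚ.≤-respˡ-≃ lhs (ℚᵘₚ.≤-respʳ-≃ (ℚₚ.toℚᵘ-homo-+ r s) (ℚₚ.toℚᵘ-mono-≤ h))))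
  where
  lhs : ℚ.toℚᵘ (q ℚ.+ (1ℚ ℚ.+ e /suc ℓ)) ℚᵘ.≃ ℚ.toℚᵘ q ℚᵘ.+ (ℚ.toℚᵘ 1ℚ ℚᵘ.+ mkℚᵘ (+ e) ℓ)
  lhs = ℚᵘₚ.≃-trans (ℚₚ.toℚᵘ-homo-+ q (1ℚ ℚ.+ e /suc ℓ)) (ℚᵘₚ.+-congʳ (ℚ.toℚᵘ q)
    (ℚᵘₚ.≃-trans (ℚₚ.toℚᵘ-homo-+ 1ℚ (e /suc ℓ)) (ℚᵘₚ.+-congʳ (ℚ.toℚᵘ 1ℚ) (ℚₚ.toℚᵘ-fromℚᵘ (mkℚᵘ (+ e) ℓ)))))

0≤/suc : ∀ e ℓ → 0ℚ ℚ.≤ e /suc ℓ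
0≤/suc e ℓ = ℚₚ.toℚᵘ-cancel-≤ (ℚᵘₚ.≤-respʳ-≃ (ℚᵘₚ.≃-sym (ℚₚ.toℚᵘ-fromℚᵘ (mkℚᵘ (+ e) ℓ)))
  (ℚᵘ.*≤* (ℤₚ.≤-trans (ℤ.+≤+ z≤n) (ℤₚ.≤-reflexive (sym (ℤₚ.*-identityʳ (+ e)))))))

-- A positive rational is at least the reciprocal of its denominator.
/suc≤ : ∀ δ e ℓ → 0ℚ ℚ.< δ → e * ↧ₙ δ ≤ suc ℓ → e /suc ℓ ℚ.≤ δ
/suc≤ δ@(ℚ.mkℚ (+ suc a) d _) e ℓ _ h = ℚₚ.toℚᵘ-cancel-≤ (ℚᵘₚ.≤-respˡ-≃ (ℚᵘₚ.≃-sym (ℚₚ.toℚᵘ-fromℚᵘ (mkℚᵘ (+ e) ℓ)))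
  (ℚᵘ.*≤* (subst (ℤ._≤ + suc a ℤ.* + suc ℓ) (ℤₚ.pos-* e (suc d))
    (ℤ.+≤+ (≤-trans h (m≤n*m (suc ℓ) (suc a)))))))
/suc≤ (ℚ.mkℚ (+ zero) d _)  e ℓ (ℚ.*<* (ℤ.+<+ ())) h
/suc≤ (ℚ.mkℚ -[1+ _ ] d _)  e ℓ (ℚ.*<* ()) h

0<½* : ∀ {δ} → 0ℚ ℚ.< δ → 0ℚ ℚ.< ½ ℚ.* δ
0<½* {δ} 0<δ = subst (ℚ._< ½ ℚ.* δ) (ℚₚ.*-zeroʳ ½) (ℚₚ.*-monoʳ-<-pos ½ 0<δ)

∣p-q∣<r⇒p≤q+r : ∀ {p q r} → ℚ.∣ p ℚ.- q ∣ ℚ.< r → p ℚ.≤ q ℚ.+ r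
∣p-q∣<r⇒p≤q+r {p} {q} {r} h = begin
  p                       ≡⟨ solve 2 (λ p q → p := q :+ (p :- q)) refl p q ⟩
  q ℚ.+ (p ℚ.- q)         ≤⟨ ℚₚ.+-monoʳ-≤ q (ℚₚ.≤-trans p≤∣p∣ (ℚₚ.<⇒≤ h)) ⟩
  q ℚ.+ r                 ∎
  where
  open ℚₚ.≤-Reasoning
  open ℚ-Solver.+-*-Solver
  p≤∣p∣ : ∀ {p} → p ℚ.≤ ℚ.∣ p ∣
  p≤∣p∣ {ℚ.mkℚ (+ _) _ _}   = ℚₚ.≤-refl
  p≤∣p∣ {ℚ.mkℚ -[1+ _ ] _ _} = ℚ.*≤* ℤ.-≤+

-- One `η` absorbs the oscillation of the Cauchy sequence, the other is the gap that `_<ᴿ_` asks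
-- for.
close-below : ∀ x {η} → 0ℚ ℚ.< η → ∃ λ N → ∀ i → N ≤ i → fromℚ (seq x i ℚ.- (η ℚ.+ η)) <ᴿ x
close-below x {η} 0<η = let N , h = cauchy x η 0<η in N , λ i N≤i → η , 0<η , N , λ j N≤j → begin
  seq x i ℚ.- (η ℚ.+ η) ℚ.+ η  ≡⟨ solve 2 (λ x η → x :- (η :+ η) :+ η := x :- η) refl (seq x i) η ⟩
  seq x i ℚ.- η                ≤⟨ ℚₚ.+-monoˡ-≤ (ℚ.- η) (∣p-q∣<r⇒p≤q+r {seq x i} {seq x j} (h i j N≤i N≤j)) ⟩
  seq x j ℚ.+ η ℚ.- η          ≡⟨ solve 2 (λ x η → x :+ η :- η := x) refl (seq x j) η ⟩
  seq x j                      ∎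
  where
  open ℚₚ.≤-Reasoning
  open ℚ-Solver.+-*-Solver

-- The gap `δ` is shared equally between approximations of `α` and `γ` from below, taken at one
-- index late enough for both and for the hypothesis.
split-exponent : ∀ α γ q θ → fromℚ q <ᴿ ((α +ᴿ γ) -ᴿ 1ᴿ -ᴿ fromℚ θ) →
  ∃ λ r → ∃ λ s → fromℚ r <ᴿ α × fromℚ s <ᴿ γ × q ℚ.+ (1ℚ ℚ.+ θ) ℚ.≤ r ℚ.+ s
split-exponent α γ q θ (δ , 0<δ , N , h) = seq α i ℚ.- (η ℚ.+ η) , seq γ i ℚ.- (η ℚ.+ η)
  , proj₂ A i (m≤m⊔n (proj₁ A) (proj₁ B ⊔ N))
  , proj₂ B i (≤-trans (m≤m⊔n (proj₁ B) N) (m≤n⊔m (proj₁ A) (proj₁ B ⊔ N)))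
  , (begin
    q ℚ.+ (1ℚ ℚ.+ θ)
      ≡⟨ solve 3 (λ q θ δ → q :+ (con 1ℚ :+ θ) := q :+ δ :+ (con 1ℚ :+ θ :- δ)) refl q θ δ ⟩
    q ℚ.+ δ ℚ.+ (1ℚ ℚ.+ θ ℚ.- δ)
      ≤⟨ ℚₚ.+-monoˡ-≤ (1ℚ ℚ.+ θ ℚ.- δ) (h i (≤-trans (m≤n⊔m (proj₁ B) N) (m≤n⊔m (proj₁ A) (proj₁ B ⊔ N)))) ⟩
    seq α i ℚ.+ seq γ i ℚ.- 1ℚ ℚ.- θ ℚ.+ (1ℚ ℚ.+ θ ℚ.- δ)
      ≡⟨ solve 4 (λ a c θ δ → a :+ c :- con 1ℚ :- θ :+ (con 1ℚ :+ θ :- δ) :=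
           a :- (con ½ :* (con ½ :* δ) :+ con ½ :* (con ½ :* δ)) :+ (c :- (con ½ :* (con ½ :* δ) :+ con ½ :* (con ½ :* δ))))
         refl (seq α i) (seq γ i) θ δ ⟩
    seq α i ℚ.- (η ℚ.+ η) ℚ.+ (seq γ i ℚ.- (η ℚ.+ η)) ∎)
  where
  open ℚₚ.≤-Reasoning
  open ℚ-Solver.+-*-Solver
  -- A quarter of `δ`, since `close-below` spends two `η` on each of the two reals.
  η = ½ ℚ.* (½ ℚ.* δ)
  0<η = 0<½* (0<½* 0<δ)
  A = close-below α 0<η
  B = close-below γ 0<η
  i = proj₁ A ⊔ (proj₁ B ⊔ N)

-- The hard graphs and the final bound

-- The budget (1 + lg n) n eventually exceeds C n for every C, so that one graph serves all C.
hardGraph : (n : ℕ) → Digraph n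
hardGraph n with 2 ≤? n
... | yes 2≤n = proj₁ (hardest (suc (lg n) * n) 2≤n)
... | no  _   = pairSet Subset.⊥

hardGraph-hard : ∀ {n} → 2 ≤ n → ∃ λ D → 1 ≤ D × ShortcutsExist n (suc (lg n) * n) D ×
                 (∀ d H → IsShortcut d (hardGraph n) H → size H ≤ suc (lg n) * n → D ≤ d)
hardGraph-hard {n} 2≤n with 2 ≤? n
... | yes 2≤n′ = proj₂ (hardest (suc (lg n) * n) 2≤n′)
... | no  2≰n  = contradiction 2≤n 2≰n

-- Chosen so that `polylog k n` is at most n to this power, by `polylog^≤n^`.
error : ℕ → ℕ → ℚ
error k n = (2 * polylog-exponent k n) /suc lg n

error-vanishes : ∀ k → IsLittleO1 (λ n → fromℚ (error k n))
error-vanishes k δ 0<δ =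
  let N , small = polylog-exponent-small k (↧ₙ δ)
  in N , λ n N≤n →
    (λ δ′ 0<δ′ → 0 , λ _ _ → begin
      ℚ.- δ                ≤⟨ ℚₚ.neg-antimono-≤ (ℚₚ.<⇒≤ 0<δ) ⟩
      0ℚ                   ≤⟨ ℚₚ.+-mono-≤ (0≤/suc (2 * polylog-exponent k n) (lg n)) (ℚₚ.<⇒≤ 0<δ′) ⟩
      error k n ℚ.+ δ′     ∎) ,
    (λ δ′ 0<δ′ → 0 , λ _ _ → begin
      error k n            ≤⟨ /suc≤ δ _ (lg n) 0<δ (small n N≤n) ⟩
      δ                    ≡⟨ ℚₚ.+-identityʳ δ ⟨
      δ ℚ.+ 0ℚ             ≤⟨ ℚₚ.+-monoʳ-≤ δ (ℚₚ.<⇒≤ 0<δ′) ⟩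
      δ ℚ.+ δ′             ∎)
  where open ℚₚ.≤-Reasoning

-- For p = n pairs the assumed bound n^(α+γ) meets the upper bound `polylog k n * D * n` of the
-- sparse preserver; dividing by n and by the polylogarithm leaves `D`.
hops-lower-bound : ∀ {α γ k n D} → 2 ≤ n → 1 ≤ D → ShortcutsExist n (suc (lg n) * n) D →
  (Σ (Digraph n) λ G → Σ (PairSet n) λ P → size P ≡ n ×
    (∀ G′ → IsPreserver G P G′ → n ^ᴿ α · n ^ᴿ γ ≤ (k * size G′))) →
  n ^ᴿ ((α +ᴿ γ) -ᴿ 1ᴿ -ᴿ fromℚ (error k n)) ≤ D
hops-lower-bound {α} {γ} {k} {n@(suc _)} {D} 2≤n 1≤D shortcuts (G , P , ∣P∣≡n , dense) q q< =
  let L = suc (lg n)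
      e = 2 * polylog-exponent k n
      r , s , r<α , s<γ , le = split-exponent α γ q (error k n) q<
      G′ , preserver , size≤ = sparse-preserver {L = L} {s = L + L} shortcuts 1≤D (n<2^[1+lg] n) n²< G P P≤
      a = ↥ r ℤ.* ↧ s
      b = ↥ s ℤ.* ↧ r
      M = ↧ₙ r * ↧ₙ s
  in extract-power n (polylog k n) D (a ⁺ + b ⁺) (a ⁻ + b ⁻) ((↥ q) ⁺) ((↥ q) ⁻) M (↧ₙ q) L e
    {{_}} {{m*n≢0 (↧ₙ r) (↧ₙ s)}}
    (begin
      n ^ (a ⁺ + b ⁺)                                ≡⟨ ^-distribˡ-+-* n (a ⁺) (b ⁺) ⟩
      n ^ (a ⁺) * n ^ (b ⁺)                          ≤⟨ dense G′ preserver r s r<α s<γ ⟩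
      (k * size G′) ^ M * (n ^ (a ⁻) * n ^ (b ⁻))
        ≤⟨ *-mono-≤ (^-monoˡ-≤ M (≤-trans (*-monoʳ-≤ k size≤) (preserver-size≤polylog k n D)))
                    (≤-reflexive (sym (^-distribˡ-+-* n (a ⁻) (b ⁻)))) ⟩
      (polylog k n * D * n) ^ M * n ^ (a ⁻ + b ⁻)    ∎)
    (polylog^≤n^ k n 2≤n)
    (clear-denominators q r s e (lg n) le)
  where
  open ≤-Reasoning
  n²< : n * n < 2 ^ (suc (lg n) + suc (lg n))
  n²< = ≤-trans (*-mono-< (n<2^[1+lg] n) (n<2^[1+lg] n)) (≤-reflexive (sym (^-distribˡ-+-* 2 (suc (lg n)) (suc (lg n)))))
  P≤ : size P ≤ 2 * (suc (lg n) * n)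
  P≤ = ≤-trans (≤-reflexive ∣P∣≡n) (≤-trans (m≤n*m n (suc (lg n))) (m≤n*m _ 2))

^ℚ-≤-trans : ∀ n {D d} q → D ≤ d → n ^ℚ q ≤ D → n ^ℚ q ≤ d
^ℚ-≤-trans n q D≤d h = ≤-trans h (*-monoˡ-≤ (n ^ ((↥ q) ⁻)) (^-monoˡ-≤ (↧ₙ q) D≤d))

theorem1p8 : (α γ : ℝ) →
    (∃ λ (e : ℕ → ℝ) → IsLittleO1 e × (∀ n → (1ᴿ +ᴿ e n) ≤ᴿ (α +ᴿ γ))) →
    PreserverLowerBound α γ →
    Σ ((n : ℕ) → Digraph n) λ G →
    ∀ (C : ℕ) → ∃ λ (e : ℕ → ℝ) → IsLittleO1 e × (∃ λ (n₀ : ℕ) →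
    ∀ (n : ℕ) → n₀ ≤ n → ∀ (d : ℕ) (H : PairSet n) →
    IsShortcut d (G n) H → size H ≤ C * n →
    n ^ᴿ ((α +ᴿ γ) -ᴿ 1ᴿ -ᴿ e n) ≤ d)
theorem1p8 α γ _ (k , n₀ , hard) = hardGraph , λ C →
  -- From 2^C ≤ n follows C ≤ 1 + ⌊log₂ n⌋, so `C * n` edges are within the budget for which the
  -- graph is hard.
  (λ n → fromℚ (error k n)) , error-vanishes k , n₀ ⊔ (2 ⊔ 2 ^ C) , λ n N≤n d H sc H≤Cn q q< →
  let n₀≤n   = m⊔n≤o⇒m≤o n₀ (2 ⊔ 2 ^ C) N≤n
      large  = m⊔n≤o⇒n≤o n₀ (2 ⊔ 2 ^ C) N≤n
      2≤n    = m⊔n≤o⇒m≤o 2 (2 ^ C) large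
      2^C≤n  = m⊔n≤o⇒n≤o 2 (2 ^ C) large
      1≤n    = ≤-trans (n≤1+n 1) 2≤n
      D , 1≤D , shortcuts , least = hardGraph-hard 2≤n
      C≤L    = ≤-trans (≤-lg {C} 2^C≤n) (n≤1+n (lg n))
  in ^ℚ-≤-trans n q (least d H sc (≤-trans H≤Cn (*-monoˡ-≤ n C≤L)))
       (hops-lower-bound {α} {γ} {k} 2≤n 1≤D shortcuts
         (hard n n n₀≤n 1≤n (m≤m*n n n {{>-nonZero 1≤n}})) q q<)
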